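{- Let $k^*(P_\ell,2)$ be as defined in the context. Then, as $\ell\to\infty$, \[ k^*(P_\ell,2)=\Omega(\ell^{2.01}) \quad\text{and}\quad k^*(P_\ell,2)=O(\ell^{2.59}), \] i.e.\ there are constants $C_1,C_2>0$ with $C_1\ell^{2.01}\le k^*(P_\ell,2)\le C_2\ell^{2.59}$ for all sufficiently large $\ell$.
   Context: Let $r\ge 2$ be an integer and $F_1,\dots,F_r$ forests. For a positive integer $k$, the $(F_1,\dots,F_r)$-avoidance game with tree size restriction $k$ is played by Builder and Painter on a vertex-colored graph (the board), initially empty. In each step Builder adds one new vertex together with edges from some previously present vertices to it, subject to the condition that the board always remains a forest all of whose components have at most $k$ vertices; Painter then immediately and irrevocably colors the new vertex with one of the colors $1,\dots,r$. Painter loses as soon as, for some $s\in\{1,\dots,r\}$, the board contains a copy of $F_s$ (a subgraph isomorphic to $F_s$) all of whose vertices have color $s$. Builder has a winning strategy if he can force this within finitely many steps. $k^*(F_1,\dots,F_r)$ is the smallest $k$ for which Builder has a winning strategy (such $k$ exists). For a forest $F$, $k^*(F,r):=k^*(F,\dots,F)$ ($r$ copies). $P_\ell$ denotes the path on $\ell$ vertices; thus $k^*(P_\ell,2)=k^*(P_\ell,P_\ell)$ with two colors. -}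

module Defs where

open import Data.Nat using (ℕ; zero; suc; _+_; _*_; _^_; _≤_; _<_)
open import Data.Fin using (Fin)
open import Data.List using (List; []; _∷_; _++_; [_]; length)
open import Data.List.Membership.Propositional using (_∈_)
open import Data.List.Relation.Unary.All using (All)
open import Data.List.Relation.Unary.Unique.Propositional using (Unique)
open import Data.Maybe using (Maybe; just; nothing)
open import Data.Product using (Σ; _×_; _,_; proj₁; proj₂)
open import Data.Sum using (_⊎_)
open import Relation.Binary.PropositionalEquality using (_≡_)
open import Relation.Nullary using (¬_)

-- A board with n vertices is a list of n entries; vertex i (0-based position)
-- stores the list of its neighbours among the EARLIER vertices 0..i-1 (the
-- edges Builder drew when adding it) and its colour in Fin r.
Board : ℕ → Set
Board r = List (List ℕ × Fin r)

nbrsOf : ∀ {r} → Board r → ℕ → List ℕ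
nbrsOf []      _       = []
nbrsOf (x ∷ B) zero    = proj₁ x
nbrsOf (x ∷ B) (suc v) = nbrsOf B v

colorOf : ∀ {r} → Board r → ℕ → Maybe (Fin r)
colorOf []      _       = nothing
colorOf (x ∷ B) zero    = just (proj₂ x)
colorOf (x ∷ B) (suc v) = colorOf B v

Adj : ∀ {r} → Board r → ℕ → ℕ → Set
Adj B u v = (u < v × v < length B × u ∈ nbrsOf B v)
          ⊎ (v < u × u < length B × v ∈ nbrsOf B u)

data Walk {r} (B : Board r) : List ℕ → Set where
  single : ∀ {v} → v < length B → Walk B (v ∷ [])
  step   : ∀ {u v vs} → Adj B u v → Walk B (v ∷ vs) → Walk B (u ∷ v ∷ vs)

Cycle : ∀ {r} → Board r → Set
Cycle B = Σ ℕ λ v → Σ (List ℕ) λ ws →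
  (2 ≤ length ws) × Unique (v ∷ ws) × Walk B (v ∷ ws ++ [ v ])

IsForest : ∀ {r} → Board r → Set
IsForest B = ¬ Cycle B

data Connected {r} (B : Board r) : ℕ → ℕ → Set where
  here  : ∀ {v} → v < length B → Connected B v v
  there : ∀ {u w v} → Adj B u w → Connected B w v → Connected B u v

ComponentsAtMost : ∀ {r} → ℕ → Board r → Set
ComponentsAtMost k B = ∀ v (vs : List ℕ) → Unique vs → All (Connected B v) vs →
  length vs ≤ k

Legal : ∀ {r} → ℕ → Board r → Set
Legal k B = IsForest B × ComponentsAtMost k B

MonoPath : ∀ {r} → Board r → ℕ → Fin r → Set
MonoPath B ℓ s = Σ (List ℕ) λ vs →
  length vs ≡ ℓ × Unique vs × Walk B vs × All (λ v → colorOf B v ≡ just s) vs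

PainterLost : Board 2 → ℕ → Set
PainterLost B ℓ = Σ (Fin 2) λ s → MonoPath B ℓ s

-- Builder can force a win (in finitely many steps) from board B, in the
-- (P_ℓ,P_ℓ)-avoidance game with tree size restriction k.  A move: Builder
-- chooses the neighbour list N (previous vertices) of the new vertex such
-- that the resulting board is legal; Painter picks the colour c.
data BuilderWinsFrom (ℓ k : ℕ) (B : Board 2) : Set where
  lost : PainterLost B ℓ → BuilderWinsFrom ℓ k B
  move : (N : List ℕ) → All (λ u → u < length B) N →
         (∀ c → Legal k (B ++ [ (N , c) ])) →
         (∀ c → BuilderWinsFrom ℓ k (B ++ [ (N , c) ])) →
         BuilderWinsFrom ℓ k B

BuilderWins : ℕ → ℕ → Set
BuilderWins ℓ k = BuilderWinsFrom ℓ k []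

IsKStar : ℕ → ℕ → Set
IsKStar ℓ k = BuilderWins ℓ k × (∀ j → j < k → ¬ BuilderWins ℓ j)

-- Only the following data of a position matters to Builder: for each colour and
-- each m, the size f m (red) or g m (blue) of a smallest tree that contains a
-- monochromatic path on m vertices. Joining the new vertex to ends of red paths
-- on p and q vertices and of blue paths on i and j vertices makes a tree of size
-- S = f p + f q + g i + g j + 1, and Painter must accept a red path on p + q + 1
-- or a blue path on i + j + 1 vertices in it. So Painter survives exactly if
-- there are tables f, g, exceeding k at ℓ, such that f (p + q + 1) ≤ S or
-- g (i + j + 1) ≤ S for all p, q, i, j with S ≤ k. Starting from infinite tables
-- and lowering entries as long as some quadruple violates this either reaches such
-- tables or yields a strategy for Builder; this also makes the game decidable.
--
-- Upper bound: if for every n one of f n ≤ κ n, g c ≤ κ n holds, then the same is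
-- true with 2 c + 1 and 3 κ for c and κ.
--
-- Lower bound: the tables are built over a hierarchy of scales. Refining the blue
-- table by a gadget of four rows multiplies the number of rows by 4, but the slope
-- of the red table by 21/5 > 4. After n refinements the colours exchange their
-- roles for n further refinements, which balances the two path lengths.
module Submission where

open import Defs
open import Data.Fin using (Fin; zero; suc)
open import Data.List using (List; []; _∷_; _++_; [_]; length; _ʳ++_; take; replicate)
open import Data.Nat
open import Data.Nat.DivMod using (m≡m%n+[m/n]*n; m%n<n)
open import Data.Nat.Properties
open import Data.Nat.Tactic.RingSolver using (solve; solve-∀)
open import Data.Product using (Σ; ∃; _×_; _,_; proj₁; proj₂)
open import Data.Sum using (_⊎_; inj₁; inj₂; swap; [_,_]′) renaming (map to map-⊎)
open import Relation.Binary.PropositionalEquality using (_≡_; _≢_; refl; sym; trans; cong; cong₂; subst)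
open import Relation.Nullary using (¬_; Dec; yes; no; contradiction)
open import Relation.Nullary.Decidable using (True; toWitness; _×-dec_)

-- Arithmetic

-- a ≤ b is a linear combination of hypotheses implying X ≤ Y, and r the slack.
lin : ∀ {a b} r {X Y} → a ≤ b → X + b + r ≡ Y + a → X ≤ Y
lin {a} {b} r {X} {Y} h eq = +-cancelʳ-≤ b X Y
  (≤-trans (m≤m+n (X + b) r) (≤-trans (≤-reflexive eq) (+-monoʳ-≤ Y h)))

infixl 6 _⊕_
infixl 7 _⊙_

_⊕_ : ∀ {a b c d} → a ≤ b → c ≤ d → a + c ≤ b + d
_⊕_ = +-mono-≤

_⊙_ : ∀ k {a b} → a ≤ b → k * a ≤ k * b
k ⊙ h = *-monoʳ-≤ k h

m≤m+n+o : ∀ m n o → m ≤ m + n + o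
m≤m+n+o m n o = ≤-trans (m≤m+n m n) (m≤m+n (m + n) o)

left-< : ∀ p q {o} → suc (p + q) < o → p < o
left-< p q h = ≤-trans (s≤s (m≤n⇒m≤1+n (m≤m+n p q))) h

right-< : ∀ p q {o} → suc (p + q) < o → q < o
right-< p q h = ≤-trans (s≤s (m≤n⇒m≤1+n (m≤n+m q p))) h

-- Painter's tables

-- Sizes are measured in units of 1 / D, so that the tables below stay integral.
Stable : (D k : ℕ) (f g : ℕ → ℕ) → Set
Stable D k f g = ∀ p q i j → let S = f p + f q + (g i + g j) + D in
  S ≤ D * k → f (suc (p + q)) ≤ S ⊎ g (suc (i + j)) ≤ S

Table : Set
Table = Fin 2 → ℕ → ℕ

-- The red table f is defined for all lengths and grows with slope σ up to an
-- error E; the blue table g matters below c only, as if g c were infinite. Joining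
-- two red paths while completing a blue path on c vertices costs at least E.
record Level (f g : ℕ → ℕ) (c D σ E e : ℕ) : Set where
  field
    f-zero   : f 0 ≡ 0
    g-zero   : g 0 ≡ 0
    c-pos    : 1 ≤ c
    e-pos    : 1 ≤ e
    below    : ∀ p q i j → suc (i + j) < c →
               f (suc (p + q)) ≤ f p + f q + (g i + g j) + D ⊎
               g (suc (i + j)) ≤ f p + f q + (g i + g j) + D
    f-join   : ∀ p q → f (suc (p + q)) ≤ f p + f q + E
    g-close  : ∀ i j → i < c → j < c → c ≤ suc (i + j) → E ≤ g i + g j + D
    f-lower  : ∀ n → σ * suc n ≤ f n + E
    f-upper  : ∀ n → f n ≤ σ * suc n + E
    g-upper  : ∀ j → j < c → g j ≤ 2 * E
    E-upper  : E ≤ e * σ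

-- Painter always answers red: a red path on `n` vertices takes `n` vertices, and with `c = 1` only
-- the empty blue path exists.
level₀ : Level (λ n → n) (λ _ → 0) 1 1 1 1 1
level₀ = record
  { f-zero = refl ; g-zero = refl ; c-pos = ≤-refl ; e-pos = ≤-refl
  ; below = λ { _ _ _ _ (s≤s ()) }
  ; f-join = λ p q → ≤-reflexive (+-comm 1 (p + q))
  ; g-close = λ _ _ _ _ _ → ≤-refl
  ; f-lower = λ n → ≤-reflexive (solve (n ∷ []))
  ; f-upper = λ n → lin 2 (z≤n {0}) (solve (n ∷ []))
  ; g-upper = λ _ _ → z≤n
  ; E-upper = ≤-refl
  }

-- Multiplication by a numeral, kept opaque because the type checker would unroll
-- numeral * x into a sum of that many terms.
opaque
  _✶_ : ℕ → ℕ → ℕ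
  _✶_ = _*_

  ✶-def : ∀ a b → a ✶ b ≡ a * b
  ✶-def a b = refl

infixl 7 _✶_

✶-mono : ∀ {a b} x → a ≤ b → a ✶ x ≤ b ✶ x
✶-mono {a} {b} x h rewrite ✶-def a x | ✶-def b x = *-monoˡ-≤ x h

✶-+ : ∀ a b x → (a + b) ✶ x ≡ a ✶ x + b ✶ x
✶-+ a b x rewrite ✶-def (a + b) x | ✶-def a x | ✶-def b x = *-distribʳ-+ x a b

decide-≤ : ∀ a b {_ : True (a ≤? b)} → a ≤ b
decide-≤ a b {w} = toWitness w

-- In units of A = 635 x, which is about the size of a red path on w = 128 e
-- vertices after rescaling by 5, the new blue rows have sizes 3, 7 and 10. They
-- come from letting Painter switch to blue at the red lengths 3 w, 4 w and 4 w:
-- 7 = 4 + 3 and 10 = 4 + 2 * 3. The resulting red slope is (4 + 3 + 10) / 4 = 17/4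
-- times the old one, up to the error terms for which 21/5 leaves room.
module Refine {f g c D σ E e} (L : Level f g c D σ E e) where
  open Level L

  x : ℕ
  x = e * σ

  384≤512 : 384 ✶ e ≤ 512 ✶ e
  384≤512 = ✶-mono e (decide-≤ 384 512)

  opaque
    f₁ : ℕ → ℕ
    f₁ n with n <? 384 ✶ e | n <? 512 ✶ e
    ... | yes _ | _     = 5 * f n
    -- 1900 = 1905 - 5: a red join in this range costs at most this jump plus the old error `5 * E`,
    -- together the 1905 `x` that two blue blocks pay.
    ... | no _  | yes _ = 5 * f n + 1900 ✶ x
    -- As 4402 = 21 * 512 - 6350, this is the line `21 * σ * suc n` lowered by the new error 6350
    -- `x`.
    ... | no _  | no _  = 21 * σ * suc (n ∸ 512 ✶ e) + 4402 ✶ x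

    f₁-low : ∀ {n} → n < 384 ✶ e → f₁ n ≡ 5 * f n
    f₁-low {n} h with n <? 384 ✶ e | n <? 512 ✶ e
    ... | yes _ | _ = refl
    ... | no ¬h | _ = contradiction h ¬h

    f₁-mid : ∀ {n} → 384 ✶ e ≤ n → n < 512 ✶ e → f₁ n ≡ 5 * f n + 1900 ✶ x
    f₁-mid {n} h h′ with n <? 384 ✶ e | n <? 512 ✶ e
    ... | yes ¬h | _      = contradiction h (<⇒≱ ¬h)
    ... | no _   | yes _  = refl
    ... | no _   | no ¬h′ = contradiction h′ ¬h′

    f₁-top : ∀ {n} → 512 ✶ e ≤ n → f₁ n + 6350 ✶ x ≡ 21 * σ * suc n
    f₁-top {n} h with n <? 384 ✶ e | n <? 512 ✶ e
    ... | yes ¬h | _      = contradiction (≤-trans 384≤512 h) (<⇒≱ ¬h)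
    ... | no _   | yes ¬h = contradiction h (<⇒≱ ¬h)
    ... | no _   | no _   = subst (λ m → 21 * σ * suc (n ∸ 512 ✶ e) + 4402 ✶ x + 6350 ✶ x ≡ 21 * σ * suc m)
                              (m∸n+n≡m h) (eq (n ∸ 512 ✶ e) σ e (✶-def 512 e) (✶-def 4402 x) (✶-def 6350 x))
      where
      eq : ∀ r σ e {T Y Z} → T ≡ 512 * e → Y ≡ 4402 * (e * σ) → Z ≡ 6350 * (e * σ) →
           21 * σ * suc r + Y + Z ≡ 21 * σ * suc (r + T)
      eq r σ e refl refl refl = solve (r ∷ σ ∷ e ∷ [])

  c≤2c : c ≤ 2 * c
  c≤2c = m≤m+n c _

  2c≤3c : 2 * c ≤ 3 * c
  2c≤3c = *-monoˡ-≤ c (n≤1+n 2)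

  x-mono : ∀ {a b} → a ≤ b → a ✶ x ≤ b ✶ x
  x-mono = ✶-mono x

  5g≤10x : ∀ {j} → j < c → 5 * g j ≤ 10 ✶ x
  5g≤10x {j} h = ≤-trans (go (g j) E x (g-upper j h) E-upper) (≤-reflexive (sym (✶-def 10 x)))
    where
    go : ∀ G E x → G ≤ 2 * E → E ≤ x → 5 * G ≤ 10 * x
    go G E x h h′ = lin 0 (5 ⊙ h ⊕ 10 ⊙ h′) (solve (G ∷ E ∷ x ∷ []))

  opaque
    g₁ : ℕ → ℕ
    g₁ j with j <? c | j <? 2 * c | j <? 3 * c
    ... | yes _ | _     | _     = 5 * g j
    ... | no _  | yes _ | _     = 1905 ✶ x
    ... | no _  | no _  | yes _ = 4445 ✶ x
    ... | no _  | no _  | no _  = 6350 ✶ x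

    g₁-old : ∀ {j} → j < c → g₁ j ≡ 5 * g j
    g₁-old {j} h with j <? c | j <? 2 * c | j <? 3 * c
    ... | yes _ | _ | _ = refl
    ... | no ¬h | _ | _ = contradiction h ¬h

    g₁-≥c : ∀ {j} → c ≤ j → 1905 ✶ x ≤ g₁ j
    g₁-≥c {j} h with j <? c | j <? 2 * c | j <? 3 * c
    ... | yes ¬h | _     | _     = contradiction h (<⇒≱ ¬h)
    ... | no _   | yes _ | _     = ≤-refl
    ... | no _   | no _  | yes _ = x-mono (decide-≤ 1905 4445)
    ... | no _   | no _  | no _  = x-mono (decide-≤ 1905 6350)

    g₁-≥2c : ∀ {j} → 2 * c ≤ j → 4445 ✶ x ≤ g₁ j
    g₁-≥2c {j} h with j <? c | j <? 2 * c | j <? 3 * c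
    ... | yes ¬h | _      | _     = contradiction (≤-trans c≤2c h) (<⇒≱ ¬h)
    ... | no _   | yes ¬h | _     = contradiction h (<⇒≱ ¬h)
    ... | no _   | no _   | yes _ = ≤-refl
    ... | no _   | no _   | no _  = x-mono (decide-≤ 4445 6350)

    g₁-≥3c : ∀ {j} → 3 * c ≤ j → 6350 ✶ x ≤ g₁ j
    g₁-≥3c {j} h with j <? c | j <? 2 * c | j <? 3 * c
    ... | yes ¬h | _      | _      = contradiction (≤-trans c≤2c (≤-trans 2c≤3c h)) (<⇒≱ ¬h)
    ... | no _   | yes ¬h | _      = contradiction (≤-trans 2c≤3c h) (<⇒≱ ¬h)
    ... | no _   | no _   | yes ¬h = contradiction h (<⇒≱ ¬h)
    ... | no _   | no _   | no _   = ≤-refl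

    g₁-<2c : ∀ {j} → j < 2 * c → g₁ j ≤ 1905 ✶ x
    g₁-<2c {j} h with j <? c | j <? 2 * c | j <? 3 * c
    ... | yes h′ | _     | _ = ≤-trans (5g≤10x h′) (x-mono (decide-≤ 10 1905))
    ... | no _   | yes _ | _ = ≤-refl
    ... | no _   | no ¬h | _ = contradiction h ¬h

    g₁-<3c : ∀ {j} → j < 3 * c → g₁ j ≤ 4445 ✶ x
    g₁-<3c {j} h with j <? c | j <? 2 * c | j <? 3 * c
    ... | yes h′ | _     | _     = ≤-trans (5g≤10x h′) (x-mono (decide-≤ 10 4445))
    ... | no _   | yes _ | _     = x-mono (decide-≤ 1905 4445)
    ... | no _   | no _  | yes _ = ≤-refl
    ... | no _   | no _  | no ¬h = contradiction h ¬h

    g₁-≤ : ∀ j → g₁ j ≤ 6350 ✶ x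
    g₁-≤ j with j <? c | j <? 2 * c | j <? 3 * c
    ... | yes h′ | _     | _     = ≤-trans (5g≤10x h′) (x-mono (decide-≤ 10 6350))
    ... | no _   | yes _ | _     = x-mono (decide-≤ 1905 6350)
    ... | no _   | no _  | yes _ = x-mono (decide-≤ 4445 6350)
    ... | no _   | no _  | no _  = ≤-refl

  f₁-large : ∀ {n} → 512 ✶ e ≤ n → 4402 ✶ x ≤ f₁ n
  f₁-large {n} h = go (f₁ n) n σ e (✶-def 512 e) (✶-def 4402 x) (✶-def 6350 x) h (f₁-top h)
    where
    go : ∀ F n σ e {T Y Z} → T ≡ 512 * e → Y ≡ 4402 * (e * σ) → Z ≡ 6350 * (e * σ) →
         T ≤ n → F + Z ≡ 21 * σ * suc n → Y ≤ F
    go F n σ e refl refl refl h eq = lin (21 * σ) (21 * σ ⊙ h ⊕ ≤-reflexive (sym eq)) (solve (F ∷ n ∷ σ ∷ e ∷ []))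

  5f≤f₁ : ∀ {n} → n < 512 ✶ e → 5 * f n ≤ f₁ n
  5f≤f₁ {n} h with <-≤-connex n (384 ✶ e)
  ... | inj₁ low = ≤-reflexive (sym (f₁-low low))
  ... | inj₂ mid = ≤-trans (m≤m+n (5 * f n) (1900 ✶ x)) (≤-reflexive (sym (f₁-mid mid h)))

  private
    other≥ : ∀ {a b i j} → i < a → a + b ≤ suc (i + j) → b ≤ j
    other≥ {a} {b} {i} {j} h h′ = +-cancelˡ-≤ a b j (≤-trans h′ (+-monoˡ-≤ j h))

  one-block : ∀ i j → c ≤ suc (i + j) → i < c × j < c ⊎ 1905 ✶ x ≤ g₁ i + g₁ j
  one-block i j h with <-≤-connex i c | <-≤-connex j c
  ... | inj₁ i< | inj₁ j< = inj₁ (i< , j<)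
  ... | inj₂ i≥  | _      = inj₂ (≤-trans (g₁-≥c i≥) (m≤m+n _ _))
  ... | _      | inj₂ j≥  = inj₂ (≤-trans (g₁-≥c j≥) (m≤n+m _ _))

  two-blocks : ∀ i j → 2 * c ≤ suc (i + j) → 1905 ✶ x ≤ g₁ i + g₁ j
  two-blocks i j h with <-≤-connex i c
  ... | inj₁ i< = ≤-trans (g₁-≥c (subst (_≤ j) (+-identityʳ c) (other≥ i< h))) (m≤n+m _ _)
  ... | inj₂ i≥  = ≤-trans (g₁-≥c i≥) (m≤m+n _ _)

  -- Six units of 635 `x` rather than seven: both parts may lie beyond `c` while neither reaches
  -- `2 * c`, at three units each.
  three-blocks : ∀ i j → 3 * c ≤ suc (i + j) → 3810 ✶ x ≤ g₁ i + g₁ j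
  three-blocks i j h with <-≤-connex i c | <-≤-connex i (2 * c)
  ... | inj₁ i< | _      = ≤-trans (x-mono (decide-≤ 3810 4445)) (≤-trans (g₁-≥2c (other≥ i< h)) (m≤n+m _ _))
  ... | inj₂ i≥  | inj₁ i< = ≤-trans (≤-reflexive (✶-+ 1905 1905 x))
                            (g₁-≥c i≥ ⊕ g₁-≥c (other≥ i< (≤-trans (≤-reflexive (+-comm (2 * c) c)) h)))
  ... | inj₂ _   | inj₂ i≥  = ≤-trans (x-mono (decide-≤ 3810 4445)) (≤-trans (g₁-≥2c i≥) (m≤m+n _ _))

  -- Counted in full blocks of `c`, the splits 0 + 3, 1 + 2, 2 + 1 and 3 + 0 all cost at least ten
  -- units of 635 `x`, because 10 = 3 + 7. This bound becomes the error of the refined level.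
  four-blocks : ∀ i j → 4 * c ≤ suc (i + j) → 6350 ✶ x ≤ g₁ i + g₁ j
  four-blocks i j h with <-≤-connex i c | <-≤-connex i (2 * c) | <-≤-connex i (3 * c)
  ... | inj₁ i< | _      | _      = ≤-trans (g₁-≥3c (other≥ i< h)) (m≤n+m _ _)
  ... | inj₂ i≥  | inj₁ i< | _      = ≤-trans (≤-reflexive (✶-+ 1905 4445 x))
                                    (g₁-≥c i≥ ⊕ g₁-≥2c (other≥ i< (≤-trans (≤-reflexive (sym (*-distribʳ-+ c 2 2))) h)))
  ... | inj₂ _   | inj₂ i≥  | inj₁ i< = ≤-trans (≤-reflexive (✶-+ 4445 1905 x))
                                    (g₁-≥2c i≥ ⊕ g₁-≥c (other≥ i< (≤-trans (≤-reflexive (+-comm (3 * c) c)) h)))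
  ... | inj₂ _   | inj₂ _   | inj₂ i≥  = ≤-trans (g₁-≥3c i≥) (m≤m+n _ _)

  -- By `f-lower` the two parts cost `m * x` up to one error `E ≤ x` each; rescaling by 5 leaves 5 m
  -- - 10. A part of at least 512 `e` vertices pays 4402 `x` alone.
  pieces : ∀ p q m r → m ✶ e ≤ suc (p + q) → 5 * m ≡ r + 10 → r ≤ 4402 →
           r ✶ x ≤ f₁ p + f₁ q
  pieces p q m r h eq r≤ with <-≤-connex p (512 ✶ e) | <-≤-connex q (512 ✶ e)
  ... | inj₂ p≥  | _      = ≤-trans (x-mono r≤) (≤-trans (f₁-large p≥) (m≤m+n _ _))
  ... | _      | inj₂ q≥  = ≤-trans (x-mono r≤) (≤-trans (f₁-large q≥) (m≤n+m _ _))
  ... | inj₁ p< | inj₁ q< = ≤-trans (go (f p) (f q) p q E e σ (✶-def m e) (✶-def r x) h (f-lower p) (f-lower q) E-upper) (5f≤f₁ p< ⊕ 5f≤f₁ q<)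
    where
    go : ∀ F F′ p q E e σ {T Y} → T ≡ m * e → Y ≡ r * (e * σ) → T ≤ suc (p + q) → σ * suc p ≤ F + E → σ * suc q ≤ F′ + E → E ≤ e * σ →
         Y ≤ 5 * F + 5 * F′
    go F F′ p q E e σ refl refl h h₁ h₂ h₃ =
      lin (5 * σ) (5 * σ ⊙ h ⊕ 5 ⊙ h₁ ⊕ 5 ⊙ h₂ ⊕ 10 ⊙ h₃ ⊕ ≤-reflexive (cong (_* (e * σ)) (sym eq)))
        (solve (F ∷ F′ ∷ p ∷ q ∷ E ∷ e ∷ σ ∷ m ∷ r ∷ []))

  -- The lag behind the slope `21 * σ` is bounded at the upper ends of the two lower ranges: 16 *
  -- 384 + 5 = 6149 and 16 * 512 + 5 - 1900 = 6297 in units of `x`. For the slope 17/4 in place of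
  -- 21/5 the second number would be 6425, beyond 6350.
  f₁-lower : ∀ n → 21 * σ * suc n ≤ f₁ n + 6350 ✶ x
  f₁-lower n with <-≤-connex n (384 ✶ e) | <-≤-connex n (512 ✶ e)
  ... | inj₁ low | _        = subst (λ F → 21 * σ * suc n ≤ F + 6350 ✶ x) (sym (f₁-low low))
                                (go (f n) n E e σ (✶-def 384 e) (✶-def 6350 x) (f-lower n) E-upper low)
    where
    go : ∀ F n E e σ {T Z} → T ≡ 384 * e → Z ≡ 6350 * (e * σ) →
         σ * suc n ≤ F + E → E ≤ e * σ → suc n ≤ T → 21 * σ * suc n ≤ 5 * F + Z
    go F n E e σ refl refl h₁ h₂ h₃ = lin (201 * (e * σ)) (5 ⊙ h₁ ⊕ 5 ⊙ h₂ ⊕ 16 * σ ⊙ h₃)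
                              (solve (F ∷ n ∷ E ∷ e ∷ σ ∷ []))
  ... | inj₂ mid | inj₁ mid′ = subst (λ F → 21 * σ * suc n ≤ F + 6350 ✶ x) (sym (f₁-mid mid mid′))
                                (go (f n) n E e σ (✶-def 512 e) (✶-def 1900 x) (✶-def 6350 x) (f-lower n) E-upper mid′)
    where
    go : ∀ F n E e σ {T Y Z} → T ≡ 512 * e → Y ≡ 1900 * (e * σ) → Z ≡ 6350 * (e * σ) →
         σ * suc n ≤ F + E → E ≤ e * σ → suc n ≤ T → 21 * σ * suc n ≤ 5 * F + Y + Z
    go F n E e σ refl refl refl h₁ h₂ h₃ = lin (53 * (e * σ)) (5 ⊙ h₁ ⊕ 5 ⊙ h₂ ⊕ 16 * σ ⊙ h₃)
                              (solve (F ∷ n ∷ E ∷ e ∷ σ ∷ []))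
  ... | _        | inj₂ top = ≤-reflexive (sym (f₁-top top))

  f₁-upper : ∀ n → f₁ n ≤ 21 * σ * suc n + 6350 ✶ x
  f₁-upper n with <-≤-connex n (384 ✶ e) | <-≤-connex n (512 ✶ e)
  ... | inj₁ low | _        = subst (_≤ 21 * σ * suc n + 6350 ✶ x) (sym (f₁-low low))
                                (go (f n) n E x σ (✶-def 6350 x) (f-upper n) E-upper)
    where
    go : ∀ F n E x σ {Z} → Z ≡ 6350 * x → F ≤ σ * suc n + E → E ≤ x → 5 * F ≤ 21 * σ * suc n + Z
    go F n E x σ refl h₁ h₂ = lin (16 * σ * suc n + 6345 * x) (5 ⊙ h₁ ⊕ 5 ⊙ h₂) (solve (F ∷ n ∷ E ∷ x ∷ σ ∷ []))
  ... | inj₂ mid | inj₁ mid′ = subst (_≤ 21 * σ * suc n + 6350 ✶ x) (sym (f₁-mid mid mid′))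
                                (go (f n) n E x σ (✶-def 1900 x) (✶-def 6350 x) (f-upper n) E-upper)
    where
    go : ∀ F n E x σ {Y Z} → Y ≡ 1900 * x → Z ≡ 6350 * x → F ≤ σ * suc n + E → E ≤ x → 5 * F + Y ≤ 21 * σ * suc n + Z
    go F n E x σ refl refl h₁ h₂ = lin (16 * σ * suc n + 4445 * x) (5 ⊙ h₁ ⊕ 5 ⊙ h₂) (solve (F ∷ n ∷ E ∷ x ∷ σ ∷ []))
  ... | _        | inj₂ top = ≤-trans (m≤m+n _ (6350 ✶ x)) (≤-trans (≤-reflexive (f₁-top top)) (m≤m+n _ _))

  f₁-join-low : ∀ p q → suc (p + q) < 384 ✶ e → f₁ (suc (p + q)) ≤ f₁ p + f₁ q + 5 * E
  f₁-join-low p q low = begin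
    f₁ (suc (p + q))             ≡⟨ f₁-low low ⟩
    5 * f (suc (p + q))          ≤⟨ 5 ⊙ f-join p q ⟩
    5 * (f p + f q + E)          ≡⟨ eq (f p) (f q) E ⟩
    5 * f p + 5 * f q + 5 * E    ≡⟨ cong₂ (λ a b → a + b + 5 * E) (f₁-low (left-< p q low)) (f₁-low (right-< p q low)) ⟨
    f₁ p + f₁ q + 5 * E          ∎
    where
    open ≤-Reasoning
    eq : ∀ F F′ E → 5 * (F + F′ + E) ≡ 5 * F + 5 * F′ + 5 * E
    eq = solve-∀

  f₁-join-mid : ∀ p q → 384 ✶ e ≤ suc (p + q) → suc (p + q) < 512 ✶ e → f₁ (suc (p + q)) ≤ f₁ p + f₁ q + 1905 ✶ x
  f₁-join-mid p q mid mid′ = begin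
    f₁ (suc (p + q))                   ≡⟨ f₁-mid mid mid′ ⟩
    5 * f (suc (p + q)) + 1900 ✶ x     ≤⟨ go (f (suc (p + q))) (f p) (f q) E x (✶-def 1900 x) (✶-def 1905 x) (f-join p q) E-upper ⟩
    5 * f p + 5 * f q + 1905 ✶ x       ≤⟨ +-monoˡ-≤ (1905 ✶ x) (5f≤f₁ (left-< p q mid′) ⊕ 5f≤f₁ (right-< p q mid′)) ⟩
    f₁ p + f₁ q + 1905 ✶ x             ∎
    where
    open ≤-Reasoning
    go : ∀ F₀ F F′ E x {Y Z} → Y ≡ 1900 * x → Z ≡ 1905 * x → F₀ ≤ F + F′ + E → E ≤ x → 5 * F₀ + Y ≤ 5 * F + 5 * F′ + Z
    go F₀ F F′ E x refl refl h₁ h₂ = lin 0 (5 ⊙ h₁ ⊕ 5 ⊙ h₂) (solve (F₀ ∷ F ∷ F′ ∷ E ∷ x ∷ []))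

  5E≤ : ∀ a → 5 ≤ a → 5 * E ≤ a ✶ x
  5E≤ a h = ≤-trans (5 ⊙ E-upper) (≤-trans (≤-reflexive (sym (✶-def 5 x))) (x-mono h))

  -- From 512 `e` on the table coincides with the line of `f₁-lower`, and the lower bounds for the
  -- two parts add up to that line again, up to one error.
  f₁-join : ∀ p q → f₁ (suc (p + q)) ≤ f₁ p + f₁ q + 6350 ✶ x
  f₁-join p q with <-≤-connex (suc (p + q)) (384 ✶ e) | <-≤-connex (suc (p + q)) (512 ✶ e)
  ... | inj₁ low | _         = ≤-trans (f₁-join-low p q low) (+-monoʳ-≤ (f₁ p + f₁ q) (5E≤ 6350 (decide-≤ 5 6350)))
  ... | inj₂ mid | inj₁ mid′ = ≤-trans (f₁-join-mid p q mid mid′) (+-monoʳ-≤ (f₁ p + f₁ q) (x-mono (decide-≤ 1905 6350)))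
  ... | _        | inj₂ top  = go (f₁ (suc (p + q))) (f₁ p) (f₁ q) p q σ (f₁-top top) (f₁-lower p) (f₁-lower q)
    where
    go : ∀ F₀ F F′ p q σ {Z} → F₀ + Z ≡ 21 * σ * suc (suc (p + q)) → 21 * σ * suc p ≤ F + Z →
         21 * σ * suc q ≤ F′ + Z → F₀ ≤ F + F′ + Z
    go F₀ F F′ p q σ {Z} h₁ h₂ h₃ = lin 0 (≤-reflexive h₁ ⊕ h₂ ⊕ h₃) (solve (F₀ ∷ F ∷ F′ ∷ p ∷ q ∷ σ ∷ Z ∷ []))

  -- Painter's rule depends on the red length on offer. Below 384 `e` the old level decides and blue
  -- paths on `c` or more vertices are refused; from there to 512 `e` blue is accepted only below
  -- `2 * c`; beyond, blue is always accepted.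
  f₁-below : ∀ p q i j → suc (i + j) < 4 * c →
             let S = f₁ p + f₁ q + (g₁ i + g₁ j) + 5 * D in
             f₁ (suc (p + q)) ≤ S ⊎ g₁ (suc (i + j)) ≤ S
  f₁-below p q i j h with <-≤-connex (suc (p + q)) (384 ✶ e) | <-≤-connex (suc (p + q)) (512 ✶ e)
  f₁-below p q i j h | inj₁ low | _ with <-≤-connex (suc (i + j)) c
  ... | inj₁ J< = map-⊎ (scale (f₁-low low)) (scale (g₁-old J<)) (below p q i j J<)
    where
    eq : ∀ a b c d D → 5 * (a + b + (c + d) + D) ≡ 5 * a + 5 * b + (5 * c + 5 * d) + 5 * D
    eq = solve-∀
    scale : ∀ {y y₁} → y₁ ≡ 5 * y → y ≤ f p + f q + (g i + g j) + D → y₁ ≤ f₁ p + f₁ q + (g₁ i + g₁ j) + 5 * D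
    scale refl h rewrite f₁-low (left-< p q low) | f₁-low (right-< p q low) | g₁-old (left-< i j J<) | g₁-old (right-< i j J<) =
      ≤-trans (5 ⊙ h) (≤-reflexive (eq (f p) (f q) (g i) (g j) D))
  ... | inj₂ J≥ = inj₁ (≤-trans (f₁-join-low p q low) (≤-trans (+-monoʳ-≤ (f₁ p + f₁ q) 5E≤S) (≤-reflexive (sym (+-assoc (f₁ p + f₁ q) (g₁ i + g₁ j) (5 * D))))))
    where
    eq : ∀ a b D → 5 * (a + b + D) ≡ 5 * a + 5 * b + 5 * D
    eq = solve-∀
    5E≤S : 5 * E ≤ g₁ i + g₁ j + 5 * D
    5E≤S with one-block i j J≥
    ... | inj₁ (i< , j<) rewrite g₁-old i< | g₁-old j< = ≤-trans (5 ⊙ g-close i j i< j< J≥) (≤-reflexive (eq (g i) (g j) D))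
    ... | inj₂ big       = ≤-trans (5E≤ 1905 (decide-≤ 5 1905)) (≤-trans big (m≤m+n _ _))
  f₁-below p q i j h | inj₂ mid | inj₁ mid′ with <-≤-connex (suc (i + j)) (2 * c)
  -- 1910 = 5 * 384 - 10: the red parts alone pay for the blue row 1905.
  ... | inj₁ J< = inj₂ (≤-trans (g₁-<2c J<) (≤-trans (x-mono (decide-≤ 1905 1910)) (≤-trans (pieces p q 384 1910 mid refl (decide-≤ 1910 4402))
                    (≤-trans (m≤m+n _ _) (m≤m+n _ _)))))
  ... | inj₂ J≥ = inj₁ (≤-trans (f₁-join-mid p q mid mid′) (≤-trans (+-monoʳ-≤ (f₁ p + f₁ q) (two-blocks i j J≥)) (m≤m+n _ _)))
  f₁-below p q i j h | _ | inj₂ top with <-≤-connex (suc (i + j)) (2 * c) | <-≤-connex (suc (i + j)) (3 * c)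
  -- 2550 = 5 * 512 - 10: together with 0, 1905 or 3810 from the blue parts it covers the rows 1905,
  -- 4445 and 6350.
  ... | inj₁ J< | _       = inj₂ (≤-trans (g₁-<2c J<) (≤-trans (x-mono (decide-≤ 1905 2550)) (≤-trans F≥
                              (≤-trans (m≤m+n _ _) (m≤m+n _ _)))))
    where
    F≥ : 2550 ✶ x ≤ f₁ p + f₁ q
    F≥ = pieces p q 512 2550 top refl (decide-≤ 2550 4402)
  ... | inj₂ J≥ | inj₁ J< = inj₂ (≤-trans (g₁-<3c J<) (≤-trans (x-mono (decide-≤ 4445 4455)) (≤-trans (≤-reflexive (✶-+ 2550 1905 x))
                              (≤-trans (F≥ ⊕ two-blocks i j J≥) (m≤m+n _ _)))))
    where
    F≥ : 2550 ✶ x ≤ f₁ p + f₁ q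
    F≥ = pieces p q 512 2550 top refl (decide-≤ 2550 4402)
  ... | _       | inj₂ J≥ = inj₂ (≤-trans (g₁-≤ (suc (i + j))) (≤-trans (x-mono (decide-≤ 6350 6360)) (≤-trans (≤-reflexive (✶-+ 2550 3810 x))
                              (≤-trans (F≥ ⊕ three-blocks i j J≥) (m≤m+n _ _)))))
    where
    F≥ : 2550 ✶ x ≤ f₁ p + f₁ q
    F≥ = pieces p q 512 2550 top refl (decide-≤ 2550 4402)

  refine : Level f₁ g₁ (4 * c) (5 * D) (21 * σ) (6350 ✶ x) (512 * e)
  refine = record
    { f-zero  = trans (f₁-low (≤-trans e-pos e≤384e)) (cong (5 *_) f-zero)
    ; g-zero  = trans (g₁-old c-pos) (cong (5 *_) g-zero)
    ; c-pos   = ≤-trans c-pos (m≤m+n c _)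
    ; e-pos   = ≤-trans e-pos (m≤m+n e _)
    ; below   = f₁-below
    ; f-join  = f₁-join
    ; g-close = λ i j _ _ h → ≤-trans (four-blocks i j h) (m≤m+n _ _)
    ; f-lower = f₁-lower
    ; f-upper = f₁-upper
    ; g-upper = λ j _ → ≤-trans (g₁-≤ j) (m≤m+n _ _)
    ; E-upper = ≤-trans (≤-reflexive (✶-def 6350 x)) (go e σ)
    }
    where
    e≤384e : e ≤ 384 ✶ e
    e≤384e = ≤-trans (≤-reflexive (trans (sym (*-identityˡ e)) (sym (✶-def 1 e)))) (✶-mono e (decide-≤ 1 384))
    go : ∀ e σ → 6350 * (e * σ) ≤ 512 * e * (21 * σ)
    go e σ = lin (4402 * (e * σ)) (z≤n {0}) (solve (e ∷ σ ∷ []))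

-- At the red length 6 c ν Painter switches to blue for good: the red table ends
-- there, and the blue one becomes linear.
module Turn {f g c D σ E ν} (L : Level f g c D σ E (c * ν)) where
  open Level L

  opaque
    g₂ : ℕ → ℕ
    g₂ j with j <? c
    ... | yes _ = g j
    -- With this slope the line is at least `c * ν * σ`, hence at least `E`, from `j = c` on, so
    -- that one such blue path pays for a red join.
    ... | no  _ = σ * ν * suc j

    g₂-old : ∀ {j} → j < c → g₂ j ≡ g j
    g₂-old {j} h with j <? c
    ... | yes _ = refl
    ... | no ¬h = contradiction h ¬h

    g₂-new : ∀ {j} → c ≤ j → g₂ j ≡ σ * ν * suc j
    g₂-new {j} h with j <? c
    ... | yes ¬h = contradiction h (<⇒≱ ¬h)
    ... | no _   = refl

  E≤g₂ : ∀ {j} → c ≤ j → E ≤ g₂ j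
  E≤g₂ {j} h = ≤-trans E-upper (≤-trans (go c ν σ j h) (≤-reflexive (sym (g₂-new h))))
    where
    go : ∀ c ν σ j → c ≤ j → c * ν * σ ≤ σ * ν * suc j
    go c ν σ j h = lin (σ * ν) (σ * ν ⊙ h) (solve (c ∷ ν ∷ σ ∷ j ∷ []))

  x : ℕ
  x = c * ν * σ

  E≤g₂+g₂+D : ∀ i j → c ≤ suc (i + j) → E ≤ g₂ i + g₂ j + D
  E≤g₂+g₂+D i j h with <-≤-connex i c | <-≤-connex j c
  ... | inj₂ i≥ | _       = ≤-trans (E≤g₂ i≥) (m≤m+n+o _ _ _)
  ... | _       | inj₂ j≥ = ≤-trans (E≤g₂ j≥) (≤-trans (m≤n+m (g₂ j) (g₂ i)) (m≤m+n (g₂ i + g₂ j) D))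
  ... | inj₁ i< | inj₁ j< rewrite g₂-old i< | g₂-old j< = g-close i j i< j< h

  g₂-lower : ∀ j → σ * ν * suc j ≤ g₂ j + 4 * x
  g₂-lower j with <-≤-connex j c
  ... | inj₁ j< = ≤-trans (go c ν σ j j<) (m≤n+m (4 * x) (g₂ j))
    where
    go : ∀ c ν σ j → suc j ≤ c → σ * ν * suc j ≤ 4 * (c * ν * σ)
    go c ν σ j h = lin (3 * (c * ν * σ)) (σ * ν ⊙ h) (solve (c ∷ ν ∷ σ ∷ j ∷ []))
  ... | inj₂ j≥ = ≤-trans (≤-reflexive (sym (g₂-new j≥))) (m≤m+n _ _)

  g₂-upper : ∀ j → g₂ j ≤ σ * ν * suc j + 4 * x
  g₂-upper j with <-≤-connex j c
  ... | inj₁ j< = ≤-trans (≤-reflexive (g₂-old j<)) (≤-trans (go (g j) E x (g-upper j j<) E-upper) (m≤n+m (4 * x) (σ * ν * suc j)))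
    where
    go : ∀ G E x → G ≤ 2 * E → E ≤ x → G ≤ 4 * x
    go G E x h h′ = lin (2 * x) (h ⊕ 2 ⊙ h′) (solve (G ∷ E ∷ x ∷ []))
  ... | inj₂ j≥ = ≤-trans (≤-reflexive (g₂-new j≥)) (m≤m+n _ _)

  g₂-join : ∀ i j → g₂ (suc (i + j)) ≤ g₂ i + g₂ j + 4 * x
  g₂-join i j with <-≤-connex (suc (i + j)) c | <-≤-connex i c | <-≤-connex j c
  ... | inj₁ J< | _ | _ = ≤-trans (≤-reflexive (g₂-old J<)) (≤-trans (go (g (suc (i + j))) E x (g-upper _ J<) E-upper) (m≤n+m (4 * x) (g₂ i + g₂ j)))
    where
    go : ∀ G E x → G ≤ 2 * E → E ≤ x → G ≤ 4 * x
    go G E x h h′ = lin (2 * x) (h ⊕ 2 ⊙ h′) (solve (G ∷ E ∷ x ∷ []))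
  ... | inj₂ J≥ | inj₁ i< | inj₁ j< = ≤-trans (≤-reflexive (g₂-new J≥)) (≤-trans (go c ν σ i j i< j<) (m≤n+m (4 * x) (g₂ i + g₂ j)))
    where
    go : ∀ c ν σ i j → suc i ≤ c → suc j ≤ c → σ * ν * suc (suc (i + j)) ≤ 4 * (c * ν * σ)
    go c ν σ i j h h′ = lin (2 * (c * ν * σ)) (σ * ν ⊙ h ⊕ σ * ν ⊙ h′) (solve (c ∷ ν ∷ σ ∷ i ∷ j ∷ []))
  ... | inj₂ J≥ | _ | inj₂ j≥ = ≤-trans (≤-reflexive (g₂-new J≥)) (go (g₂ i) (g₂ j) (σ * ν) x i j (g₂-lower i) (g₂-new j≥))
    where
    go : ∀ G G′ τ x i j → τ * suc i ≤ G + 4 * x → G′ ≡ τ * suc j → τ * suc (suc (i + j)) ≤ G + G′ + 4 * x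
    go G G′ τ x i j h h′ = lin 0 (h ⊕ ≤-reflexive (sym h′)) (solve (G ∷ G′ ∷ τ ∷ x ∷ i ∷ j ∷ []))
  ... | inj₂ J≥ | inj₂ i≥ | _ = ≤-trans (≤-reflexive (g₂-new J≥)) (go (g₂ i) (g₂ j) (σ * ν) x i j (g₂-new i≥) (g₂-lower j))
    where
    go : ∀ G G′ τ x i j → G ≡ τ * suc i → τ * suc j ≤ G′ + 4 * x → τ * suc (suc (i + j)) ≤ G + G′ + 4 * x
    go G G′ τ x i j h h′ = lin 0 (≤-reflexive (sym h) ⊕ h′) (solve (G ∷ G′ ∷ τ ∷ x ∷ i ∷ j ∷ []))

  -- A blue path on fewer than `c` vertices is judged by the old level. Every longer one is refused,
  -- since its parts pay the error of the red join.
  g₂-below : ∀ i j p q → suc (p + q) < 6 * (c * ν) →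
             let S = g₂ i + g₂ j + (f p + f q) + D in
             g₂ (suc (i + j)) ≤ S ⊎ f (suc (p + q)) ≤ S
  g₂-below i j p q h with <-≤-connex (suc (i + j)) c
  ... | inj₂ J≥ = inj₂ (≤-trans (f-join p q) (≤-trans (+-monoʳ-≤ (f p + f q) (E≤g₂+g₂+D i j J≥))
                    (≤-reflexive (eq (f p + f q) (g₂ i + g₂ j) D))))
    where
    eq : ∀ a b D → a + (b + D) ≡ b + a + D
    eq = solve-∀
  ... | inj₁ J< rewrite g₂-old J< | g₂-old (left-< i j J<) | g₂-old (right-< i j J<) =
    swap (map-⊎ flip flip (below p q i j J<))
    where
    flip : ∀ {y} → y ≤ f p + f q + (g i + g j) + D → y ≤ g i + g j + (f p + f q) + D
    flip {y} = subst (λ s → y ≤ s + D) (+-comm (f p + f q) (g i + g j))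

  -- Red parts completing `6 * (c * ν)` vertices cost at least 6 `x` - 2 `x` by `f-lower`, which is
  -- the new error. Shorter red paths cost at most 7 `x` by `f-upper`, within twice that error.
  turn : Level g₂ f (6 * (c * ν)) D (σ * ν) (4 * x) (4 * c)
  turn = record
    { f-zero  = trans (g₂-old c-pos) g-zero
    ; g-zero  = f-zero
    ; c-pos   = ≤-trans e-pos (m≤m+n (c * ν) _)
    ; e-pos   = ≤-trans c-pos (m≤m+n c _)
    ; below   = g₂-below
    ; f-join  = g₂-join
    ; g-close = λ p q _ _ h → go (f p) (f q) p q E (c * ν) σ D h (f-lower p) (f-lower q) E-upper
    ; f-lower = g₂-lower
    ; f-upper = g₂-upper
    ; g-upper = λ p h → go′ (f p) p E (c * ν) σ h (f-upper p) E-upper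
    ; E-upper = ≤-reflexive (eq c ν σ)
    }
    where
    eq : ∀ c ν σ → 4 * (c * ν * σ) ≡ 4 * c * (σ * ν)
    eq = solve-∀
    go : ∀ F F′ p q E e σ D → 6 * e ≤ suc (p + q) → σ * suc p ≤ F + E → σ * suc q ≤ F′ + E → E ≤ e * σ →
         4 * (e * σ) ≤ F + F′ + D
    go F F′ p q E e σ D h h₁ h₂ h₃ = lin (σ + D) (σ ⊙ h ⊕ h₁ ⊕ h₂ ⊕ 2 ⊙ h₃)
      (solve (F ∷ F′ ∷ p ∷ q ∷ E ∷ e ∷ σ ∷ D ∷ []))
    go′ : ∀ F p E e σ → suc p ≤ 6 * e → F ≤ σ * suc p + E → E ≤ e * σ → F ≤ 2 * (4 * (e * σ))
    go′ F p E e σ h h₁ h₂ = lin (e * σ) (σ ⊙ h ⊕ h₁ ⊕ h₂) (solve (F ∷ p ∷ E ∷ e ∷ σ ∷ []))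

-- From a level to stable tables

opaque
  -- The value `suc bound` stands for infinity: a sum within `bound` has no entry from `ℓ` on.
  capped : (ℓ bound : ℕ) → (ℕ → ℕ) → ℕ → ℕ
  capped ℓ bound f n with n <? ℓ
  ... | yes _ = f n
  ... | no  _ = suc bound

  capped-< : ∀ {ℓ bound f n} → n < ℓ → capped ℓ bound f n ≡ f n
  capped-< {ℓ} {n = n} h with n <? ℓ
  ... | yes _ = refl
  ... | no ¬h = contradiction h ¬h

  capped-≥ : ∀ {ℓ bound f n} → ℓ ≤ n → bound < capped ℓ bound f n
  capped-≥ {ℓ} {n = n} h with n <? ℓ
  ... | yes ¬h = contradiction h (<⇒≱ ¬h)
  ... | no _   = ≤-refl

capped-inv : ∀ {ℓ bound f n} → capped ℓ bound f n ≤ bound → n < ℓ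
capped-inv {ℓ} {n = n} h with <-≤-connex n ℓ
... | inj₁ n<ℓ = n<ℓ
... | inj₂ n≥ℓ = contradiction h (<⇒≱ (capped-≥ n≥ℓ))

-- By `f-lower` and the hypothesis, red entries from `ℓ` on exceed `D * k` anyway, so no offer
-- within the bound meets the red cut-off. A blue path on `c` or more vertices is refused, as its
-- parts pay for the red join by `g-close`.
level-stable : ∀ {f g c D σ E e ℓ k} → Level f g c D σ E e → D * k + e * σ < σ * suc ℓ →
               Stable D k (capped ℓ (D * k) f) (capped c (D * k) g)
level-stable {f} {g} {c} {D} {σ} {E} {e} {ℓ} {k} L big p q i j S≤ = go
  where
  open Level L
  f̂ ĝ : ℕ → ℕ
  f̂ = capped ℓ (D * k) f
  ĝ = capped c (D * k) g
  S : ℕ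
  S = f̂ p + f̂ q + (ĝ i + ĝ j) + D
  f̂p≤ : f̂ p ≤ S
  f̂p≤ = ≤-trans (m≤m+n (f̂ p) (f̂ q)) (m≤m+n+o _ _ D)
  f̂q≤ : f̂ q ≤ S
  f̂q≤ = ≤-trans (m≤n+m (f̂ q) (f̂ p)) (m≤m+n+o _ _ D)
  ĝ≤ : ĝ i + ĝ j ≤ S
  ĝ≤ = ≤-trans (m≤n+m (ĝ i + ĝ j) (f̂ p + f̂ q)) (m≤m+n _ D)
  ĝi≤ : ĝ i ≤ S
  ĝi≤ = ≤-trans (m≤m+n (ĝ i) (ĝ j)) ĝ≤
  ĝj≤ : ĝ j ≤ S
  ĝj≤ = ≤-trans (m≤n+m (ĝ j) (ĝ i)) ĝ≤
  p< : p < ℓ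
  p< = capped-inv (≤-trans f̂p≤ S≤)
  q< : q < ℓ
  q< = capped-inv (≤-trans f̂q≤ S≤)
  i< : i < c
  i< = capped-inv (≤-trans ĝi≤ S≤)
  j< : j < c
  j< = capped-inv (≤-trans ĝj≤ S≤)
  S≡ : S ≡ f p + f q + (g i + g j) + D
  S≡ = cong₂ (λ a b → a + b + D) (cong₂ _+_ (capped-< p<) (capped-< q<)) (cong₂ _+_ (capped-< i<) (capped-< j<))
  f-case : f (suc (p + q)) ≤ f p + f q + (g i + g j) + D → f̂ (suc (p + q)) ≤ S
  f-case h with <-≤-connex (suc (p + q)) ℓ
  ... | inj₁ n< = ≤-trans (≤-reflexive (capped-< n<)) (≤-trans h (≤-reflexive (sym S≡)))
  ... | inj₂ n≥ = contradiction (≤-trans (≤-trans h (≤-reflexive (sym S≡))) S≤) (<⇒≱ (bound (f (suc (p + q))) (suc (p + q)) n≥ (f-lower _)))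
    where
    bound : ∀ F n → ℓ ≤ n → σ * suc n ≤ F + E → D * k < F
    bound F n h h′ = +-cancelʳ-≤ (e * σ) (suc (D * k)) F
      (≤-trans big (≤-trans (*-monoʳ-≤ σ (s≤s h)) (≤-trans h′ (+-monoʳ-≤ F E-upper))))
  go : f̂ (suc (p + q)) ≤ S ⊎ ĝ (suc (i + j)) ≤ S
  go with <-≤-connex (suc (i + j)) c
  ... | inj₁ J< = map-⊎ f-case (λ h → ≤-trans (≤-reflexive (capped-< J<)) (≤-trans h (≤-reflexive (sym S≡)))) (below p q i j J<)
  ... | inj₂ J≥ = inj₁ (f-case (≤-trans (f-join p q) (≤-trans (+-monoʳ-≤ (f p + f q) (g-close i j i< j< J≥))
                    (≤-reflexive (sym (+-assoc (f p + f q) (g i + g j) D))))))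

-- Iterated refinement and comparison of powers

^-distrib-* : ∀ a b n → (a * b) ^ n ≡ a ^ n * b ^ n
^-distrib-* a b zero    = refl
^-distrib-* a b (suc n) = trans (cong (a * b *_) (^-distrib-* a b n)) (eq a b (a ^ n) (b ^ n))
  where
  eq : ∀ a b A B → a * b * (A * B) ≡ a * A * (b * B)
  eq = solve-∀

level-cong : ∀ {f g c c′ D D′ σ σ′ E e e′} → c ≡ c′ → D ≡ D′ → σ ≡ σ′ → e ≡ e′ →
             Level f g c D σ E e → Level f g c′ D′ σ′ E e′
level-cong refl refl refl refl L = L

^-suc : ∀ a n b → a * (a ^ n * b) ≡ a ^ suc n * b
^-suc a n b = sym (*-assoc a (a ^ n) b)

refine-many : ∀ n {f g c D σ E e} → Level f g c D σ E e →
              ∃ λ f′ → ∃ λ g′ → ∃ λ E′ → Level f′ g′ (4 ^ n * c) (5 ^ n * D) (21 ^ n * σ) E′ (512 ^ n * e)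
refine-many zero {f} {g} {c} {D} {σ} {E} {e} L =
  f , g , E , level-cong (sym (*-identityˡ c)) (sym (*-identityˡ D)) (sym (*-identityˡ σ)) (sym (*-identityˡ e)) L
refine-many (suc n) {c = c} {D} {σ} {e = e} L with refine-many n L
... | f , g , E , L′ = _ , _ , _ , level-cong (^-suc 4 n c) (^-suc 5 n D) (^-suc 21 n σ) (^-suc 512 n e) (Refine.refine L′)

-- The first phase reaches `c = 4 ^ n`, `σ = 21 ^ n`, `e = 512 ^ n`, so the turn has `ν = 128 ^ n`.
-- It leaves `c = 6 * 512 ^ n`, `σ = 2688 ^ n`, `e = 4 * 4 ^ n`, which the second phase multiplies
-- by `4 ^ n`, `21 ^ n`, `512 ^ n` again.
tower : ∀ n → ∃ λ f → ∃ λ g → ∃ λ E →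
        Level f g (6 * 2048 ^ n) (25 ^ n) (56448 ^ n) E (4 * 2048 ^ n)
tower n with refine-many n level₀
... | f , g , E , L with refine-many n (Turn.turn (level-cong refl refl refl e≡ L))
  where
  e≡ : 512 ^ n * 1 ≡ 4 ^ n * 1 * 128 ^ n
  e≡ = trans (*-identityʳ (512 ^ n)) (trans (^-distrib-* 4 128 n) (cong (_* 128 ^ n) (sym (*-identityʳ (4 ^ n)))))
... | f′ , g′ , E′ , L′ = f′ , g′ , E′ , level-cong c≡ D≡ σ≡ e≡ L′
  where
  c≡ : 4 ^ n * (6 * (4 ^ n * 1 * 128 ^ n)) ≡ 6 * 2048 ^ n
  c≡ = trans (eq (4 ^ n) (128 ^ n)) (cong (6 *_) (trans (cong (4 ^ n *_) (sym (^-distrib-* 4 128 n))) (sym (^-distrib-* 4 512 n))))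
    where
    eq : ∀ a b → a * (6 * (a * 1 * b)) ≡ 6 * (a * (a * b))
    eq = solve-∀
  D≡ : 5 ^ n * (5 ^ n * 1) ≡ 25 ^ n
  D≡ = trans (cong (5 ^ n *_) (*-identityʳ (5 ^ n))) (sym (^-distrib-* 5 5 n))
  σ≡ : 21 ^ n * (21 ^ n * 1 * 128 ^ n) ≡ 56448 ^ n
  σ≡ = trans (cong (λ v → 21 ^ n * (v * 128 ^ n)) (*-identityʳ (21 ^ n)))
         (trans (cong (21 ^ n *_) (sym (^-distrib-* 21 128 n))) (sym (^-distrib-* 21 2688 n)))
  e≡ : 512 ^ n * (4 * (4 ^ n * 1)) ≡ 4 * 2048 ^ n
  e≡ = trans (eq (512 ^ n) (4 ^ n)) (cong (4 *_) (sym (^-distrib-* 512 4 n)))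
    where
    eq : ∀ a b → a * (4 * (b * 1)) ≡ 4 * (a * b)
    eq = solve-∀

-- With `M = 2048 ^ n` the cut-offs are `8 * M` for red and `6 * M` for blue. Half of the red cost
-- `8 * M * σ` absorbs the error `4 * M * σ`; the other half bounds the size.
stable-tables : ∀ n k → 25 ^ n * k < 4 * (2048 ^ n * 56448 ^ n) →
  ∃ λ f → ∃ λ g → Stable (25 ^ n) k f g × f 0 ≡ 0 × g 0 ≡ 0 ×
    (∀ m → 8 * 2048 ^ n ≤ m → 25 ^ n * k < f m) × (∀ m → 8 * 2048 ^ n ≤ m → 25 ^ n * k < g m)
stable-tables n k h with tower n
... | f , g , E , L =
  _ , _ , level-stable L (go (2048 ^ n) (56448 ^ n) (25 ^ n * k) h) ,
  trans (capped-< (≤-trans (m^n>0 2048 n) (m≤m+n (2048 ^ n) _))) f-zero , trans (capped-< c-pos) g-zero ,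
  (λ m → capped-≥) ,
  (λ m m≥ → capped-≥ (≤-trans (*-monoˡ-≤ (2048 ^ n) (decide-≤ 6 8)) m≥))
  where
  open Level L
  go : ∀ M σ K → K < 4 * (M * σ) → K + 4 * M * σ < σ * suc (8 * M)
  go M σ K h = lin σ h (solve (M ∷ σ ∷ K ∷ []))

^-swap : ∀ a m n → (a ^ m) ^ n ≡ (a ^ n) ^ m
^-swap a m n = trans (^-*-assoc a m n) (trans (cong (a ^_) (*-comm m n)) (sym (^-*-assoc a n m)))

-- A scale has length `P` and tree size about `P * Q / R`, with growth exponent `r / s`. `A` bridges
-- the gap to the next scale, and `B` absorbs the constants.
power-transfer : ∀ r s {ℓ A B P Q R k} .{{_ : NonZero R}} → ℓ ≤ A * P → A ^ r ≤ (B * 4) ^ s → P ^ r * R ^ s ≤ (P * Q) ^ s →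
                 4 * (P * Q) ≤ R * k → ℓ ^ r ≤ (B * k) ^ s
power-transfer r s {ℓ} {A} {B} {P} {Q} {R} {k} ℓ≤ A≤ P≤ PQ≤ = begin
  ℓ ^ r                  ≤⟨ ^-monoˡ-≤ r ℓ≤ ⟩
  (A * P) ^ r            ≡⟨ ^-distrib-* A P r ⟩
  A ^ r * P ^ r          ≤⟨ *-monoˡ-≤ (P ^ r) A≤ ⟩
  (B * 4) ^ s * P ^ r    ≡⟨ cong (_* P ^ r) (^-distrib-* B 4 s) ⟩
  B ^ s * 4 ^ s * P ^ r  ≡⟨ *-assoc (B ^ s) _ _ ⟩
  B ^ s * (4 ^ s * P ^ r) ≤⟨ *-monoʳ-≤ (B ^ s) (*-cancelˡ-≤ (R ^ s) {{m^n≢0 R s}} scaled) ⟩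
  B ^ s * k ^ s          ≡⟨ ^-distrib-* B k s ⟨
  (B * k) ^ s            ∎
  where
  open ≤-Reasoning
  eq : ∀ a b c → a * (b * c) ≡ b * (c * a)
  eq = solve-∀
  scaled : R ^ s * (4 ^ s * P ^ r) ≤ R ^ s * k ^ s
  scaled = begin
    R ^ s * (4 ^ s * P ^ r)   ≡⟨ eq (R ^ s) (4 ^ s) (P ^ r) ⟩
    4 ^ s * (P ^ r * R ^ s)   ≤⟨ *-monoʳ-≤ (4 ^ s) P≤ ⟩
    4 ^ s * (P * Q) ^ s       ≡⟨ ^-distrib-* 4 (P * Q) s ⟨
    (4 * (P * Q)) ^ s         ≤⟨ ^-monoˡ-≤ s PQ≤ ⟩
    (R * k) ^ s               ≡⟨ ^-distrib-* R k s ⟩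
    R ^ s * k ^ s             ∎

growth-power : ∀ r s a b c n → a ^ r * c ^ s ≤ (a * b) ^ s → (a ^ n) ^ r * (c ^ n) ^ s ≤ (a ^ n * b ^ n) ^ s
growth-power r s a b c n h = begin
  (a ^ n) ^ r * (c ^ n) ^ s   ≡⟨ cong₂ _*_ (^-swap a n r) (^-swap c n s) ⟩
  (a ^ r) ^ n * (c ^ s) ^ n   ≡⟨ ^-distrib-* (a ^ r) (c ^ s) n ⟨
  (a ^ r * c ^ s) ^ n         ≤⟨ ^-monoˡ-≤ n h ⟩
  ((a * b) ^ s) ^ n           ≡⟨ ^-swap (a * b) s n ⟩
  ((a * b) ^ n) ^ s           ≡⟨ cong (_^ s) (^-distrib-* a b n) ⟩
  (a ^ n * b ^ n) ^ s         ∎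
  where open ≤-Reasoning

lower-bound : ∀ n ℓ k → ℓ < 8 * 2048 ^ suc n → 4 * (2048 ^ n * 56448 ^ n) ≤ 25 ^ n * k →
              ℓ ^ 201 ≤ (2 ^ 27 * k) ^ 100
lower-bound n ℓ k ℓ< =
  -- 16384 = 8 * 2048 reaches up to the next scale. As powers of two the constants compare by 14 *
  -- 201 = 2814 and 29 * 100 = 2900.
  power-transfer 201 100 {A = 16384} {B = 2 ^ 27} {P = 2048 ^ n} {Q = 56448 ^ n} {R = 25 ^ n} {k = k} {{m^n≢0 25 n}}
    (≤-trans (<⇒≤ ℓ<) (≤-reflexive (sym (*-assoc 8 2048 (2048 ^ n)))))
    (≤ᵇ⇒≤ (16384 ^ 201) ((2 ^ 27 * 4) ^ 100) _)
    -- The rate suffices because 2048 to the power 1.01 is below 56448 / 25.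
    (growth-power 201 100 2048 56448 25 n (≤ᵇ⇒≤ (2048 ^ 201 * 25 ^ 100) ((2048 * 56448) ^ 100) _))

-- Since log 3 / log 2 < 1.59, the factor `3 ^ t` is at most `ℓ` to the power 1.59.
upper-bound : ∀ t ℓ k → 2 ^ t ≤ ℓ → k ≤ 3 ^ t * ℓ → k ^ 100 ≤ 1 ^ 100 * ℓ ^ 259
upper-bound t ℓ k ℓ≥ k≤ = go 100 159 (≤ᵇ⇒≤ (3 ^ 100) (2 ^ 159) _)
  where
  open ≤-Reasoning
  go : ∀ r s → 3 ^ r ≤ 2 ^ s → k ^ r ≤ 1 ^ r * ℓ ^ (s + r)
  go r s h = begin
    k ^ r                 ≤⟨ ^-monoˡ-≤ r k≤ ⟩
    (3 ^ t * ℓ) ^ r       ≡⟨ ^-distrib-* (3 ^ t) ℓ r ⟩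
    (3 ^ t) ^ r * ℓ ^ r   ≡⟨ cong (_* ℓ ^ r) (^-swap 3 t r) ⟩
    (3 ^ r) ^ t * ℓ ^ r   ≤⟨ *-monoˡ-≤ (ℓ ^ r) (^-monoˡ-≤ t h) ⟩
    (2 ^ s) ^ t * ℓ ^ r   ≡⟨ cong (_* ℓ ^ r) (^-swap 2 s t) ⟩
    (2 ^ t) ^ s * ℓ ^ r   ≤⟨ *-monoˡ-≤ (ℓ ^ r) (^-monoˡ-≤ s ℓ≥) ⟩
    ℓ ^ s * ℓ ^ r         ≡⟨ ^-distribˡ-+-* ℓ s r ⟨
    ℓ ^ (s + r)           ≡⟨ *-identityˡ _ ⟨
    1 * ℓ ^ (s + r)       ≡⟨ cong (_* ℓ ^ (s + r)) (^-zeroˡ r) ⟨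
    1 ^ r * ℓ ^ (s + r)   ∎

-- No stable tables beyond 3 ^ t * ℓ

first-excess : ∀ (f : ℕ → ℕ) κ n → (∀ m → m ≤ n → f m ≤ κ * m) ⊎
               (∃ λ m → m ≤ n × κ * m < f m × (∀ p → p < m → f p ≤ κ * p))
first-excess f κ zero with <-≤-connex (κ * 0) (f 0)
... | inj₁ h = inj₂ (0 , z≤n , h , λ _ ())
... | inj₂ h = inj₁ λ { zero z≤n → h }
first-excess f κ (suc n) with first-excess f κ n
... | inj₂ (m , m≤n , rest) = inj₂ (m , m≤n⇒m≤1+n m≤n , rest)
... | inj₁ all with <-≤-connex (κ * suc n) (f (suc n))
...   | inj₁ h = inj₂ (suc n , ≤-refl , h , λ { p (s≤s p≤n) → all p p≤n })
...   | inj₂ h = inj₁ λ m m≤1+n → [ (λ { (s≤s m≤n) → all m m≤n }) , (λ { refl → h }) ]′ (m≤n⇒m<n∨m≡n m≤1+n)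

Either : (k : ℕ) (f g : ℕ → ℕ) (c κ : ℕ) → Set
Either k f g c κ = ∀ n → κ * n ≤ k → f n ≤ κ * n ⊎ g c ≤ κ * n

module _ {k f g} (stable : Stable 1 k f g) (f-zero : f 0 ≡ 0) (g-zero : g 0 ≡ 0) where

  -- Builder prolongs a red path vertex by vertex; the first blue answer is a blue path on one
  -- vertex.
  either-one : Either k f g 1 1
  either-one zero    _ = inj₁ (≤-reflexive f-zero)
  either-one (suc n) h with either-one n (≤-trans (*-monoʳ-≤ 1 (n≤1+n n)) h)
  ... | inj₂ g≤ = inj₂ (≤-trans g≤ (*-monoʳ-≤ 1 (n≤1+n n)))
  ... | inj₁ f≤ = map-⊎ (λ h′ → ≤-trans (≤-reflexive (cong (λ m → f (suc m)) (sym (+-identityʳ n)))) (≤-trans h′ S≤)) (λ h′ → ≤-trans h′ S≤)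
                    (stable n 0 0 0 (≤-trans S≤ (≤-trans h (≤-reflexive (sym (+-identityʳ k))))))
    where
    go : ∀ F F₀ G n → F ≤ 1 * n → F₀ ≡ 0 → G ≡ 0 → F + F₀ + (G + G) + 1 ≤ 1 * suc n
    go F .0 .0 n h refl refl = lin 0 h (solve (F ∷ n ∷ []))
    S≤ : f n + f 0 + (g 0 + g 0) + 1 ≤ 1 * suc n
    S≤ = go (f n) (f 0) (g 0) n f≤ f-zero g-zero

  -- Let m be minimal with κ m < f m, so that g c ≤ κ m. A red path on n vertices
  -- splits into pieces shorter than m and n / m separating vertices, each of which
  -- would close two blue paths on c vertices and thus costs at most 2 κ m.
  either-double : ∀ {c κ} → 1 ≤ κ → Either k f g c κ → Either k f g (suc (c + c)) (3 * κ)
  either-double {c} {κ} 1≤κ either n h with first-excess f κ n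
  ... | inj₁ all = inj₁ (≤-trans (all n ≤-refl) (*-monoˡ-≤ n (m≤m+n κ _)))
  ... | inj₂ (zero , _ , h₀ , _) = contradiction (≤-trans h₀ (≤-reflexive f-zero)) λ ()
  ... | inj₂ (suc m , m<n , f> , f≤) = map-⊎ done (λ z → z) (pieces (n / suc m) (n % suc m) (m%n<n n (suc m)) (≤-reflexive (sym n≡)))
    where
    κ-mono : ∀ {a} → a ≤ n → 3 * κ * a ≤ k
    κ-mono a≤n = ≤-trans (*-monoʳ-≤ (3 * κ) a≤n) h
    g≤ : g c ≤ κ * suc m
    g≤ with either (suc m) (≤-trans (*-monoˡ-≤ (suc m) (m≤m+n κ _)) (κ-mono m<n))
    ... | inj₁ f≤ = contradiction f≤ (<⇒≱ f>)
    ... | inj₂ g≤ = g≤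
    n≡ : n ≡ n / suc m * suc m + n % suc m
    n≡ = trans (m≡m%n+[m/n]*n n (suc m)) (+-comm (n % suc m) _)
    -- Each of the `N` separators adds two blue paths of size at most `κ * suc m`; its own unit fits
    -- because `κ * m + 1 ≤ κ * suc m`.
    pieces : ∀ N r → r < suc m → N * suc m + r ≤ n →
             f (N * suc m + r) ≤ κ * (N * suc m + r) + 2 * κ * (N * suc m) ⊎ g (suc (c + c)) ≤ 3 * κ * n
    pieces zero r r< _ = inj₁ (≤-trans (f≤ r r<) (m≤m+n _ _))
    pieces (suc N) r r< ≤n with pieces N r r< (≤-trans (+-monoˡ-≤ r (m≤n+m _ (suc m))) ≤n)
    ... | inj₂ g≤ = inj₂ g≤
    ... | inj₁ F≤ = map-⊎ (λ h′ → subst (λ v → f v ≤ T) (cong suc (sym (+-assoc m (N * suc m) r))) (≤-trans h′ S≤T))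
                          (λ h′ → ≤-trans h′ (≤-trans S≤T (≤-trans T≤ (*-monoʳ-≤ (3 * κ) ≤n))))
                          (stable m (N * suc m + r) c c (≤-trans S≤T (≤-trans T≤ (≤-trans (κ-mono ≤n) (≤-reflexive (sym (+-identityʳ k)))))))
      where
      T : ℕ
      T = κ * (suc N * suc m + r) + 2 * κ * (suc N * suc m)
      go : ∀ F F′ G κ m N r → F ≤ κ * m → F′ ≤ κ * (N * suc m + r) + 2 * κ * (N * suc m) → G ≤ κ * suc m → 1 ≤ κ →
           F + F′ + (G + G) + 1 ≤ κ * (suc N * suc m + r) + 2 * κ * (suc N * suc m)
      go F F′ G κ m N r h₁ h₂ h₃ h₄ = lin 0 (h₁ ⊕ h₂ ⊕ 2 ⊙ h₃ ⊕ h₄) (solve (F ∷ F′ ∷ G ∷ κ ∷ m ∷ N ∷ r ∷ []))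
      S≤T : f m + f (N * suc m + r) + (g c + g c) + 1 ≤ T
      S≤T = go (f m) (f (N * suc m + r)) (g c) κ m N r (f≤ m ≤-refl) F≤ g≤ 1≤κ
      T≤ : T ≤ 3 * κ * (suc N * suc m + r)
      T≤ = go′ κ m N r
        where
        go′ : ∀ κ m N r → κ * (suc N * suc m + r) + 2 * κ * (suc N * suc m) ≤ 3 * κ * (suc N * suc m + r)
        go′ κ m N r = lin (2 * κ * r) (z≤n {0}) (solve (κ ∷ m ∷ N ∷ r ∷ []))
    done : f (n / suc m * suc m + n % suc m) ≤ κ * (n / suc m * suc m + n % suc m) + 2 * κ * (n / suc m * suc m) → f n ≤ 3 * κ * n
    done F≤ = subst (λ v → f v ≤ 3 * κ * v) (sym n≡) (≤-trans F≤ (go κ (n / suc m * suc m) (n % suc m)))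
      where
      go : ∀ κ a r → κ * (a + r) + 2 * κ * a ≤ 3 * κ * (a + r)
      go κ a r = lin (2 * κ * r) (z≤n {0}) (solve (κ ∷ a ∷ r ∷ []))

  either-power : ∀ t → ∃ λ c → suc c ≡ 2 ^ suc t × Either k f g c (3 ^ t)
  either-power zero    = 1 , refl , either-one
  either-power (suc t) with either-power t
  ... | c , eq , either = suc (c + c) , trans (cong suc (sym (+-suc c c))) (trans (cong₂ _+_ eq eq) (cong (2 ^ suc t +_) (sym (+-identityʳ _)))) ,
                          either-double (m^n>0 3 t) either

-- At `n = ℓ` the budget is exactly `3 ^ t * ℓ`, and the blue length `c = 2 ^ suc t - 1` is at least
-- `ℓ`, so both alternatives are too expensive.
unstable : ∀ {ℓ t f g} → ℓ < 2 ^ suc t → f 0 ≡ 0 → g 0 ≡ 0 →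
           (∀ m → ℓ ≤ m → 3 ^ t * ℓ < f m) → (∀ m → ℓ ≤ m → 3 ^ t * ℓ < g m) → ¬ Stable 1 (3 ^ t * ℓ) f g
unstable {ℓ} {t} {f} {g} ℓ< f-zero g-zero f> g> stable with either-power {f = f} {g} stable f-zero g-zero t
... | c , eq , either with either ℓ ≤-refl
...   | inj₁ f≤ = <⇒≱ (f> ℓ ≤-refl) f≤
...   | inj₂ g≤ = <⇒≱ (g> c (s≤s⁻¹ (≤-trans ℓ< (≤-reflexive (sym eq))))) g≤

bracket : ∀ (h : ℕ → ℕ) {ℓ} N → h 0 ≤ ℓ → ℓ < h N → ∃ λ n → h n ≤ ℓ × ℓ < h (suc n)
bracket h zero    lo hi = contradiction lo (<⇒≱ hi)
bracket h {ℓ} (suc N) lo hi with <-≤-connex ℓ (h N)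
... | inj₁ ℓ< = bracket h N lo ℓ<
... | inj₂ ℓ≥ = N , ℓ≥ , hi

-- Boards, walks and components

open import Data.Fin.Properties using () renaming (_≟_ to _≟F_)
open import Data.List.Membership.Propositional using (_∈_; _∉_)
open import Data.List.Membership.Propositional.Properties using (∈-++⁺ˡ; ∈-++⁺ʳ; ∈-++⁻; ∈-∃++)
open import Data.List.Properties using (length-++; length-ʳ++; ++-assoc; ++-identityʳ; length-take; length-replicate)
open import Data.List.Relation.Binary.Disjoint.Propositional using (Disjoint)
open import Data.List.Relation.Unary.All as All using (All; []; _∷_)
open import Data.List.Relation.Unary.All.Properties using (¬Any⇒All¬; All¬⇒¬Any) renaming (++⁺ to all-++; take⁺ to all-take)
open import Data.List.Relation.Unary.AllPairs using (AllPairs; []; _∷_)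
open import Data.List.Relation.Unary.Any using (here; there)
open import Data.List.Relation.Unary.Unique.Propositional using (Unique)
open import Data.List.Relation.Unary.Unique.Propositional.Properties using () renaming (++⁺ to unique-++; take⁺ to unique-take)
open import Data.Maybe using (just)
open import Data.Maybe.Properties using (just-injective)
open import Function using (_∘_)
open import Data.List.Membership.DecPropositional _≟_ using (_∈?_)

Mono : ∀ {r} → Board r → Fin r → List ℕ → Set
Mono B s = All (λ v → colorOf B v ≡ just s)

module _ {r} (B : Board r) where

  adj-sym : ∀ {u v} → Adj B u v → Adj B v u
  adj-sym (inj₁ e) = inj₂ e
  adj-sym (inj₂ e) = inj₁ e

  adj-<ʳ : ∀ {u v} → Adj B u v → v < length B
  adj-<ʳ (inj₁ (_ , v< , _)) = v<
  adj-<ʳ (inj₂ (v<u , u< , _)) = <-trans v<u u<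

  adj-<ˡ : ∀ {u v} → Adj B u v → u < length B
  adj-<ˡ e = adj-<ʳ (adj-sym e)

module _ {r} {B : Board r} where

  walk-< : ∀ {vs} → Walk B vs → All (_< length B) vs
  walk-< (single v<)  = v< ∷ []
  walk-< (step e w)   = adj-<ˡ B e ∷ walk-< w

  conn-<ʳ : ∀ {u v} → Connected B u v → v < length B
  conn-<ʳ (here v<)    = v<
  conn-<ʳ (there _ c)  = conn-<ʳ c

  conn-trans : ∀ {u v w} → Connected B u v → Connected B v w → Connected B u w
  conn-trans (here _)    d = d
  conn-trans (there e c) d = there e (conn-trans c d)

  conn-sym : ∀ {u v} → Connected B u v → Connected B v u
  conn-sym (here v<)   = here v<
  conn-sym (there e c) = conn-trans (conn-sym c) (there (adj-sym B e) (here (adj-<ˡ B e)))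

  walk-conn : ∀ {x vs} → Walk B (x ∷ vs) → All (Connected B x) (x ∷ vs)
  walk-conn (single v<) = here v< ∷ []
  walk-conn (step e w)  = here (adj-<ˡ B e) ∷ All.map (there e) (walk-conn w)

  -- The part before `v` is read backwards into the accumulator, so that both arms of a path through
  -- `v` start at `v`; `walk-join` glues such arms.
  walk-split : ∀ {a v bs} acc rest → Walk B (a ∷ acc) → Walk B (a ∷ rest ++ v ∷ bs) →
               Walk B (v ∷ (rest ʳ++ (a ∷ acc))) × Walk B (v ∷ bs)
  walk-split acc []         w (step e w′) = step (adj-sym B e) w , w′
  walk-split acc (y ∷ rest) w (step e w′) = walk-split (_ ∷ acc) rest (step (adj-sym B e) w) w′

  walk-join : ∀ {v acc} ps → Walk B (v ∷ ps) → Walk B (v ∷ acc) → Walk B (ps ʳ++ (v ∷ acc))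
  walk-join []       _          w = w
  walk-join (p ∷ ps) (step e w′) w = walk-join ps w′ (step (adj-sym B e) w)

  -- `Walk` does not expose its last vertex, which is needed to close a cycle at a new vertex.
  data Trail : ℕ → ℕ → List ℕ → Set where
    stop : ∀ {v} → v < length B → Trail v v [ v ]
    edge   : ∀ {u w v vs} → Adj B u w → Trail w v vs → Trail u v (u ∷ vs)

  trail-suffix : ∀ {u w v vs} → Trail w v vs → Unique vs → u ∈ vs → ∃ λ vs′ → Trail u v vs′ × Unique vs′
  trail-suffix t@(stop _) uq       (here refl) = _ , t , uq
  trail-suffix t@(edge _ _) uq       (here refl) = _ , t , uq
  trail-suffix (edge _ t)   (_ ∷ uq) (there u∈)  = trail-suffix t uq u∈

  -- Loop erasure: if the new first vertex recurs, the trail restarts at that occurrence.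
  conn-trail : ∀ {u v} → Connected B u v → ∃ λ vs → Trail u v vs × Unique vs
  conn-trail (here v<) = _ , stop v< , [] ∷ []
  conn-trail {u} (there e c) with conn-trail c
  ... | vs , t , uq with u ∈? vs
  ...   | yes u∈ = trail-suffix t uq u∈
  ...   | no u∉  = u ∷ vs , edge e t , ¬Any⇒All¬ vs u∉ ∷ uq

  trail-< : ∀ {u v vs} → Trail u v vs → All (_< length B) vs
  trail-< (stop v<) = v< ∷ []
  trail-< (edge e t)  = adj-<ˡ B e ∷ trail-< t

module _ {a} {A : Set a} where

  unique-cons : ∀ {x : A} {xs} → x ∉ xs → Unique xs → Unique (x ∷ xs)
  unique-cons {xs = xs} x∉ uq = ¬Any⇒All¬ xs x∉ ∷ uq

  unique-∉ : ∀ {x : A} {xs} → Unique (x ∷ xs) → x ∉ xs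
  unique-∉ (x≢ ∷ _) = All¬⇒¬Any x≢

  unique-join : ∀ ps {acc : List A} → Unique ps → Unique acc → Disjoint ps acc → Unique (ps ʳ++ acc)
  unique-join []       _            uacc _    = uacc
  unique-join (p ∷ ps) u@(_ ∷ ups) uacc disj = unique-join ps ups (unique-cons (λ p∈ → disj (here refl , p∈)) uacc)
    λ { (x∈ , here refl) → unique-∉ u x∈ ; (x∈ , there x∈′) → disj (there x∈ , x∈′) }

  unique-split : ∀ ps {acc bs : List A} → Unique acc → Unique (ps ++ bs) → Disjoint acc (ps ++ bs) →
                 Unique (ps ʳ++ acc) × Unique bs × Disjoint (ps ʳ++ acc) bs
  unique-split []       uacc ubs disj = uacc , ubs , disj
  unique-split (p ∷ ps) uacc u@(_ ∷ ups) disj =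
    unique-split ps (unique-cons (λ p∈ → disj (p∈ , here refl)) uacc) ups
      λ { (here refl , x∈) → unique-∉ u x∈ ; (there x∈ , x∈′) → disj (x∈ , there x∈′) }

  module _ {p} {P : A → Set p} where

    all-join : ∀ ps {acc} → All P ps → All P acc → All P (ps ʳ++ acc)
    all-join []       []         q = q
    all-join (_ ∷ ps) (px ∷ pxs) q = all-join ps pxs (px ∷ q)

    all-split : ∀ ps {bs} → All P (ps ++ bs) → All P ps × All P bs
    all-split []       q        = [] , q
    all-split (_ ∷ ps) (px ∷ q) with all-split ps q
    ... | qs , rs = px ∷ qs , rs

-- Adding one vertex to a board

module Extend {r} (B : Board r) (N : List ℕ) (N< : All (_< length B) N) where

  new : ℕ
  new = length B

  _▷_ : Fin r → Board r
  _▷_ c = B ++ [ (N , c) ]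

  length-▷ : ∀ c → length (_▷_ c) ≡ suc new
  length-▷ c = trans (length-++ B) (+-comm new 1)

  nbrs-old : ∀ (B : Board r) {x} v → v < length B → nbrsOf (B ++ [ x ]) v ≡ nbrsOf B v
  nbrs-old (_ ∷ _) zero    _        = refl
  nbrs-old (_ ∷ B) (suc v) (s≤s v<) = nbrs-old B v v<

  nbrs-new : ∀ (B : Board r) x → nbrsOf (B ++ [ x ]) (length B) ≡ proj₁ x
  nbrs-new []      x = refl
  nbrs-new (_ ∷ B) x = nbrs-new B x

  color-old′ : ∀ (B : Board r) {x} v → v < length B → colorOf (B ++ [ x ]) v ≡ colorOf B v
  color-old′ (_ ∷ _) zero    _        = refl
  color-old′ (_ ∷ B) (suc v) (s≤s v<) = color-old′ B v v<

  color-new′ : ∀ (B : Board r) x → colorOf (B ++ [ x ]) (length B) ≡ just (proj₂ x)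
  color-new′ []      x = refl
  color-new′ (_ ∷ B) x = color-new′ B x

  module _ {c : Fin r} where

    B′ : Board r
    B′ = _▷_ c

    color-old : ∀ {v} → v < new → colorOf B′ v ≡ colorOf B v
    color-old {v} = color-old′ B v

    color-new : colorOf B′ new ≡ just c
    color-new = color-new′ B _

    <-old : ∀ {v} → v < new → v < length B′
    <-old v< = ≤-trans (m≤n⇒m≤1+n v<) (≤-reflexive (sym (length-▷ c)))

    new-< : new < length B′
    new-< = ≤-reflexive (sym (length-▷ c))

    <-inv : ∀ {v} → v < length B′ → v ≢ new → v < new
    <-inv v< v≢ = ≤∧≢⇒< (s≤s⁻¹ (≤-trans v< (≤-reflexive (length-▷ c)))) v≢

    adj-old : ∀ {u v} → Adj B u v → Adj B′ u v
    adj-old {u} {v} (inj₁ (u<v , v< , u∈)) = inj₁ (u<v , <-old v< , subst (u ∈_) (sym (nbrs-old B v v<)) u∈)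
    adj-old {u} {v} (inj₂ (v<u , u< , v∈)) = inj₂ (v<u , <-old u< , subst (v ∈_) (sym (nbrs-old B u u<)) v∈)

    adj-inv : ∀ {u v} → u < new → v < new → Adj B′ u v → Adj B u v
    adj-inv {u} {v} u< v< (inj₁ (u<v , _ , u∈)) = inj₁ (u<v , v< , subst (u ∈_) (nbrs-old B v v<) u∈)
    adj-inv {u} {v} u< v< (inj₂ (v<u , _ , v∈)) = inj₂ (v<u , u< , subst (v ∈_) (nbrs-old B u u<) v∈)

    adj-new : ∀ {u} → u ∈ N → Adj B′ new u
    adj-new {u} u∈ = inj₂ (All.lookup N< u∈ , new-< , subst (u ∈_) (sym (nbrs-new B _)) u∈)

    adj-new-inv : ∀ {u} → Adj B′ new u → u ∈ N
    adj-new-inv {u} (inj₁ (n<u , u< , _)) = contradiction (≤-trans (s≤s n<u) (≤-trans u< (≤-reflexive (length-▷ c)))) (n≮n _)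
    adj-new-inv {u} (inj₂ (_ , _ , u∈))   = subst (u ∈_) (nbrs-new B _) u∈

    mono-old : ∀ {s vs} → All (_< new) vs → Mono B s vs → Mono B′ s vs
    mono-old []         []       = []
    mono-old (v< ∷ vs<) (m ∷ ms) = trans (color-old v<) m ∷ mono-old vs< ms

    mono-inv : ∀ {s vs} → All (_< new) vs → Mono B′ s vs → Mono B s vs
    mono-inv []         []       = []
    mono-inv (v< ∷ vs<) (m ∷ ms) = trans (sym (color-old v<)) m ∷ mono-inv vs< ms

    walk-old : ∀ {vs} → Walk B vs → Walk B′ vs
    walk-old (single v<) = single (<-old v<)
    walk-old (step e w)  = step (adj-old e) (walk-old w)

    walk-inv : ∀ {vs} → Walk B′ vs → new ∉ vs → Walk B vs
    walk-inv (single v<) n∉ = single (<-inv v< λ { refl → n∉ (here refl) })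
    walk-inv (step {u} {v} e w) n∉ =
      step (adj-inv (<-inv (adj-<ˡ B′ e) λ { refl → n∉ (here refl) })
                    (<-inv (adj-<ʳ B′ e) λ { refl → n∉ (there (here refl)) }) e)
           (walk-inv w (n∉ ∘ there))

    conn-old : ∀ {u v} → Connected B u v → Connected B′ u v
    conn-old (here v<)   = here (<-old v<)
    conn-old (there e c) = there (adj-old e) (conn-old c)

    trail-walk : ∀ {u v vs} → Trail {B = B} u v vs → v ∈ N → Adj B′ new u → Walk B′ (new ∷ vs ++ [ new ])
    trail-walk (stop v<) v∈ e = step e (step (adj-sym B′ (adj-new v∈)) (single new-<))
    trail-walk (edge e′ t) v∈ e = step e (edge-walk e′ t)
      where
      edge-walk : ∀ {u w vs} → Adj B u w → Trail w _ vs → Walk B′ (u ∷ vs ++ [ new ])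
      edge-walk e (stop v<) = step (adj-old e) (step (adj-sym B′ (adj-new v∈)) (single new-<))
      edge-walk e (edge e′ t) = step (adj-old e) (edge-walk e′ t)

    -- Otherwise a simple trail between two different neighbours closes to a cycle through the new
    -- vertex.
    forest-separates : IsForest B′ → ∀ {u v} → u ∈ N → v ∈ N → Connected B u v → u ≡ v
    forest-separates forest {u} {v} u∈ v∈ conn with u ≟ v
    ... | yes eq = eq
    ... | no u≢v with conn-trail conn
    ...   | vs , t , uq = contradiction (new , vs , long t , unique-cons n∉ uq , trail-walk t v∈ (adj-new u∈)) forest
      where
      n∉ : new ∉ vs
      n∉ n∈ = n≮n _ (All.lookup (trail-< t) n∈)
      long : ∀ {vs} → Trail {B = B} u v vs → 2 ≤ length vs
      long (stop _)          = contradiction refl u≢v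
      long (edge _ (stop _))   = s≤s (s≤s z≤n)
      long (edge _ (edge _ _))   = s≤s (s≤s z≤n)

-- Painter's strategy from stable tables

module Painter (D k : ℕ) (t : Table) (t-zero : ∀ s → t s 0 ≡ 0) (stable : Stable D k (t zero) (t (suc zero))) where

  Big : Board 2 → ℕ → ℕ → Set
  Big B v S = ∃ λ cs → Unique cs × All (Connected B v) cs × S ≤ D * length cs

  -- The table as an invariant: a path on `m` vertices of colour `s` lies in a component of at least
  -- `t s m / D` vertices. The double negation avoids deciding which vertices are connected, and it
  -- suffices because the goal is a negation.
  Inv : Board 2 → Set
  Inv B = ∀ s v vs → Walk B (v ∷ vs) → Unique (v ∷ vs) → Mono B s (v ∷ vs) → ¬ ¬ Big B v (t s (suc (length vs)))

  big-conn : ∀ {B u v S} → Connected B u v → Big B v S → Big B u S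
  big-conn u~v (cs , uq , conn , S≤) = cs , uq , All.map (conn-trans u~v) conn , S≤

  module Step (B : Board 2) (inv : Inv B) (N : List ℕ) (N< : All (_< length B) N)
              (legal : ∀ c → Legal k (B ++ [ (N , c) ])) where
    open Extend B N N<

    Bad : Fin 2 → Set
    Bad c = ∃ λ as → ∃ λ bs → let vs = as ++ new ∷ bs in
      Walk (_▷_ c) vs × Unique vs × Mono (_▷_ c) c vs × ¬ Big (_▷_ c) new (t c (suc (length as + length bs)))

    -- Old components only grow, so only paths through the new vertex can break the invariant.
    inv-extend : ∀ c → ¬ Bad c → Inv (_▷_ c)
    inv-extend c ¬bad s v vs w uq mono ¬big with new ∈? (v ∷ vs)
    ... | no n∉ = inv s v vs w′ uq (mono-inv (walk-< w′) mono)
                    λ { (cs , ucs , conn , S≤) → ¬big (cs , ucs , All.map conn-old conn , S≤) }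
      where
      w′ : Walk B (v ∷ vs)
      w′ = walk-inv w n∉
    ... | yes n∈ with ∈-∃++ n∈
    ...   | as , bs , eq = ¬bad (as , bs , subst (Walk (_▷_ c)) eq w , subst Unique eq uq , subst (Mono (_▷_ c) c) eq mono′ ,
                             ¬big ∘ subst (Big (_▷_ c) v) (cong₂ t c≡s len) ∘ big-conn (All.lookup (walk-conn w) n∈))
      where
      c≡s : c ≡ s
      c≡s = just-injective (trans (sym color-new) (All.lookup mono n∈))
      mono′ : Mono (_▷_ c) c (v ∷ vs)
      mono′ = subst (λ s → Mono (_▷_ c) s (v ∷ vs)) (sym c≡s) mono
      len : suc (length as + length bs) ≡ suc (length vs)
      len = trans (sym (+-suc (length as) (length bs))) (trans (sym (length-++ as)) (cong length (sym eq)))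

    Hang : List ℕ → List ℕ → Set
    Hang as cs = Unique cs × All (λ y → ∃ λ u → u ∈ as × Connected B u y) cs

    -- Distinct neighbours of the new vertex lie in distinct old components, so what hangs from them
    -- is disjoint and the sizes add up.
    hang-++ : ∀ {as bs cs ds} → All (_∈ N) as → All (_∈ N) bs → Disjoint as bs → Hang as cs → Hang bs ds → Hang (as ++ bs) (cs ++ ds)
    hang-++ {as} as∈ bs∈ disj (ucs , conn) (uds , conn′) =
      unique-++ ucs uds (λ { (y∈cs , y∈ds) → clash (All.lookup conn y∈cs) (All.lookup conn′ y∈ds) }) ,
      all-++ (All.map (λ { (u , u∈ , c) → u , ∈-++⁺ˡ u∈ , c }) conn) (All.map (λ { (u , u∈ , c) → u , ∈-++⁺ʳ as u∈ , c }) conn′)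
      where
      clash : ∀ {y} → (∃ λ u → u ∈ as × Connected B u y) → ¬ (∃ λ u → u ∈ _ × Connected B u y)
      clash (u , u∈ , c) (u′ , u′∈ , c′)
        with forest-separates (proj₁ (legal zero)) (All.lookup as∈ u∈) (All.lookup bs∈ u′∈) (conn-trans c (conn-sym c′))
      ... | refl = disj (u∈ , u′∈)

    -- Half of a path cut at the new vertex; `take 1 ps` is its end next to `new`, or nothing for an
    -- empty half.
    record Arm (c : Fin 2) (ps : List ℕ) : Set where
      field
        at∈  : All (_∈ N) (take 1 ps)
        at-c : Mono B c (take 1 ps)
        hung : ¬ ¬ (∃ λ cs → Hang (take 1 ps) cs × t c (length ps) ≤ D * length cs)

    arm : ∀ {c} ps → Walk (_▷_ c) (new ∷ ps) → Unique (new ∷ ps) → Mono (_▷_ c) c ps → Arm c ps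
    arm {c} [] _ _ _ = record
      { at∈ = [] ; at-c = [] ; hung = λ ¬h → ¬h ([] , ([] , []) , ≤-trans (≤-reflexive (t-zero c)) z≤n) }
    arm {c} (p ∷ ps) (step e w) u@(_ ∷ ups) mono = record
      { at∈  = adj-new-inv {c} e ∷ []
      ; at-c = All.head mono′ ∷ []
      ; hung = λ ¬h → inv c p ps w′ ups mono′
          λ { (cs , ucs , conn , S≤) → ¬h (cs , (ucs , All.map (λ c → p , here refl , c) conn) , S≤) }
      }
      where
      w′ : Walk B (p ∷ ps)
      w′ = walk-inv w (unique-∉ u)
      mono′ : Mono B c (p ∷ ps)
      mono′ = mono-inv (walk-< w′) mono

    take-disjoint : ∀ {ps qs : List ℕ} → Disjoint ps qs → Disjoint (take 1 ps) (take 1 qs)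
    take-disjoint {p ∷ _} {q ∷ _} disj (here refl , here refl) = disj (here refl , here refl)

    record Arms (c : Fin 2) (m : ℕ) : Set where
      field
        {as}  : List ℕ
        as∈   : All (_∈ N) as
        as-c  : Mono B c as
        p q   : ℕ
        m≡    : m ≡ suc (p + q)
        hung  : ¬ ¬ (∃ λ cs → Hang as cs × t c p + t c q ≤ D * length cs)

    arms : ∀ {c} as bs → Walk (_▷_ c) (as ++ new ∷ bs) → Unique (as ++ new ∷ bs) → Mono (_▷_ c) c (as ++ new ∷ bs) →
           Arms c (suc (length as + length bs))
    arms {c} as bs w uq mono = record
      { as∈  = all-++ A.at∈ B.at∈
      ; as-c = all-++ A.at-c B.at-c
      ; p    = length (as ʳ++ [])
      ; q    = length bs
      ; m≡   = cong (λ l → suc (l + length bs)) (sym (trans (length-ʳ++ as) (+-identityʳ (length as))))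
      ; hung = λ ¬h → A.hung λ { (cs , h , ≤cs) → B.hung λ { (ds , h′ , ≤ds) →
          ¬h (cs ++ ds , hang-++ A.at∈ B.at∈ (take-disjoint (λ { (x∈ , x∈′) → disj (x∈ , there x∈′) })) h h′ ,
              ≤-trans (+-mono-≤ ≤cs ≤ds) (≤-reflexive (trans (sym (*-distribˡ-+ D (length cs) (length ds))) (cong (D *_) (sym (length-++ cs)))))) } }
      }
      where
      split : Unique (as ʳ++ []) × Unique (new ∷ bs) × Disjoint (as ʳ++ []) (new ∷ bs)
      split = unique-split as [] uq λ ()
      disj : Disjoint (as ʳ++ []) (new ∷ bs)
      disj = proj₂ (proj₂ split)
      walks : ∀ as → Walk (_▷_ c) (as ++ new ∷ bs) → Walk (_▷_ c) (new ∷ (as ʳ++ [])) × Walk (_▷_ c) (new ∷ bs)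
      walks []       w = single new-< , w
      walks (a ∷ as) w = walk-split [] as (single (All.head (walk-< w))) w
      monos : Mono (_▷_ c) c as × Mono (_▷_ c) c (new ∷ bs)
      monos = all-split as mono
      module A = Arm (arm (as ʳ++ []) (proj₁ (walks as w)) (unique-cons (λ n∈ → disj (n∈ , here refl)) (proj₁ split)) (all-join as (proj₁ monos) []))
      module B = Arm (arm bs (proj₂ (walks as w)) (proj₁ (proj₂ split)) (All.tail (proj₂ monos)))

    -- A red and a blue violation provide the four lengths of `Stable`. Their arms start at distinct
    -- neighbours, those of the two violations being told apart by colour, so the new component has
    -- at least `S / D` vertices. By legality it has at most `k`, and stability then refutes one
    -- violation.
    not-both-bad : Bad zero → ¬ Bad (suc zero)
    not-both-bad (as , bs , w , uq , mono , ¬big) (as′ , bs′ , w′ , uq′ , mono′ , ¬big′) =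
      R.hung λ { (cs , h , ≤cs) → L.hung λ { (ds , h′ , ≤ds) →
        let hang   = hang-++ R.as∈ L.as∈ disj h h′
            S      = t zero R.p + t zero R.q + (t (suc zero) L.p + t (suc zero) L.q) + D
            whole  = new ∷ cs ++ ds
            S≤     = ≤-trans (+-monoˡ-≤ D (+-mono-≤ ≤cs ≤ds)) (≤-reflexive (size cs ds))
            unique = unique-cons (λ n∈ → n≮n _ (conn-<ʳ (proj₂ (proj₂ (All.lookup (proj₂ hang) n∈))))) (proj₁ hang)
            conn : ∀ c → All (Connected (_▷_ c) new) whole
            conn   = λ c → here (new-< {c}) ∷ All.map (λ { (u , u∈ , u~y) → there (adj-new {c} (All.lookup (all-++ R.as∈ L.as∈) u∈)) (conn-old u~y) }) (proj₂ hang)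
            small  = proj₂ (legal zero) new whole unique (conn zero)
        in [ (λ ≤S → ¬big (whole , unique , conn zero , ≤-trans (subst (λ m → t zero m ≤ S) (sym R.m≡) ≤S) S≤))
           , (λ ≤S → ¬big′ (whole , unique , conn (suc zero) , ≤-trans (subst (λ m → t (suc zero) m ≤ S) (sym L.m≡) ≤S) S≤)) ]′
           (stable R.p R.q L.p L.q (≤-trans S≤ (*-monoʳ-≤ D small))) } }
      where
      module R = Arms (arms as bs w uq mono)
      module L = Arms (arms as′ bs′ w′ uq′ mono′)
      disj : Disjoint R.as L.as
      disj (x∈ , x∈′) with just-injective (trans (sym (All.lookup R.as-c x∈)) (All.lookup L.as-c x∈′))
      ... | ()
      size : ∀ cs ds → D * length cs + D * length ds + D ≡ D * suc (length (cs ++ ds))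
      size cs ds = trans (cong (_+ D) (trans (sym (*-distribˡ-+ D (length cs) (length ds))) (cong (D *_) (sym (length-++ cs)))))
                     (trans (+-comm _ D) (sym (*-suc D (length (cs ++ ds)))))

    inv-step : ¬ (∀ c → ¬ Inv (_▷_ c))
    inv-step ¬inv = ¬inv zero (inv-extend zero λ bad → ¬inv (suc zero) (inv-extend (suc zero) (not-both-bad bad)))

  module _ {ℓ} (t> : ∀ s → D * k < t s ℓ) where

    -- Induction on Builder's strategy tree. No answer of Painter has to be computed: `inv-step`
    -- excludes that both fail.
    survives : ∀ {B} → Inv B → ComponentsAtMost k B → ¬ BuilderWinsFrom ℓ k B
    survives inv small (lost (s , [] , len , uq , () , mono))
    survives inv small (lost (s , v ∷ vs , refl , uq , w , mono)) = inv s v vs w uq mono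
      λ { (cs , ucs , conn , t≤) → <⇒≱ (t> s) (≤-trans t≤ (*-monoʳ-≤ D (small v cs ucs conn))) }
    survives {B} inv small (move N N< legal cont) =
      Step.inv-step B inv N N< legal λ c inv′ → survives inv′ (proj₂ (legal c)) (cont c)

    painter-wins : ¬ BuilderWins ℓ k
    painter-wins = survives (λ { s v vs (single ()) ; s v _ (step (inj₁ (_ , () , _)) _) ; s v _ (step (inj₂ (_ , () , _)) _) })
      λ { v [] _ _ → z≤n ; v (_ ∷ _) _ (here () ∷ _) ; v (_ ∷ _) _ (there (inj₁ (_ , () , _)) _ ∷ _) ; v (_ ∷ _) _ (there (inj₂ (_ , () , _)) _ ∷ _) }

-- Builder's strategy when there are no stable tables

allPairs-++⁻ : ∀ {a r} {A : Set a} {R : A → A → Set r} xs {ys} → AllPairs R (xs ++ ys) →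
               AllPairs R xs × AllPairs R ys × All (λ x → All (R x) ys) xs
allPairs-++⁻ []       q        = [] , q , []
allPairs-++⁻ (x ∷ xs) (rx ∷ q) with all-split xs rx | allPairs-++⁻ xs q
... | rx₁ , rx₂ | q₁ , q₂ , q₃ = rx₁ ∷ q₁ , q₂ , rx₂ ∷ q₃

unique-swap : ∀ {a} {A : Set a} (xs : List A) {ys} → Unique (xs ++ ys) → Unique (ys ++ xs)
unique-swap xs uq with allPairs-++⁻ xs uq
... | ux , uy , apart = unique-++ uy ux λ { (y∈ , x∈) → All.lookup (All.lookup apart x∈) y∈ refl }

unique-⊆-length : ∀ {a} {A : Set a} {xs ys : List A} → Unique xs → (∀ {x} → x ∈ xs → x ∈ ys) → length xs ≤ length ys
unique-⊆-length {xs = []}     _          _   = z≤n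
unique-⊆-length {xs = x ∷ xs} u@(_ ∷ uq) sub with ∈-∃++ (sub (here refl))
... | as , bs , refl = ≤-trans (s≤s (unique-⊆-length uq rest))
                         (≤-reflexive (trans (cong suc (length-++ as)) (trans (sym (+-suc _ _)) (sym (length-++ as)))))
  where
  rest : ∀ {y} → y ∈ xs → y ∈ as ++ bs
  rest y∈ with ∈-++⁻ as (sub (there y∈))
  ... | inj₁ y∈as         = ∈-++⁺ˡ y∈as
  ... | inj₂ (here refl)  = contradiction y∈ (unique-∉ u)
  ... | inj₂ (there y∈bs) = ∈-++⁺ʳ as y∈bs

module _ {r} {B : Board r} where

  walk-prefix : ∀ xs {v ys} → Walk B (xs ++ v ∷ ys) → Walk B (xs ++ [ v ])
  walk-prefix []           w          = single (All.head (walk-< w))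
  walk-prefix (x ∷ [])     (step e w) = step e (walk-prefix [] w)
  walk-prefix (x ∷ y ∷ xs) (step e w) = step e (walk-prefix (y ∷ xs) w)

  walk-++ : ∀ xs {v ys} → Walk B (xs ++ [ v ]) → Walk B (v ∷ ys) → Walk B (xs ++ v ∷ ys)
  walk-++ []           _          w = w
  walk-++ (x ∷ [])     (step e _) w = step e w
  walk-++ (x ∷ y ∷ xs) (step e v) w = step e (walk-++ (y ∷ xs) v w)

  walk-suffix : ∀ xs {v ys} → Walk B (xs ++ v ∷ ys) → Walk B (v ∷ ys)
  walk-suffix []           w          = w
  walk-suffix (x ∷ [])     (step e w) = w
  walk-suffix (x ∷ y ∷ xs) (step e w) = walk-suffix (y ∷ xs) w

  walk-take : ∀ n {vs} → Walk B vs → Walk B (take (suc n) vs)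
  walk-take zero    (single v<) = single v<
  walk-take (suc n) (single v<) = single v<
  walk-take zero    (step e w)  = single (adj-<ˡ B e)
  walk-take (suc n) (step e w)  = step e (walk-take n w)

-- A union of components, as a list of vertices.
record Closed {r} (B : Board r) (C : List ℕ) : Set where
  constructor closed
  field
    inside : All (_< length B) C
    absorb : ∀ {x y} → x ∈ C → Adj B x y → y ∈ C

  absorb-conn : ∀ {x y} → x ∈ C → Connected B x y → y ∈ C
  absorb-conn x∈ (here _)    = x∈
  absorb-conn x∈ (there e c) = absorb-conn (absorb x∈ e) c

closed-++ : ∀ {r} {B : Board r} {C D} → Closed B C → Closed B D → Closed B (C ++ D)
closed-++ {C = C} (closed C< C-abs) (closed D< D-abs) =
  closed (all-++ C< D<) λ x∈ e → [ (λ x∈C → ∈-++⁺ˡ (C-abs x∈C e)) , (λ x∈D → ∈-++⁺ʳ C (D-abs x∈D e)) ]′ (∈-++⁻ C x∈)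

-- `X` covers the components that a new vertex with neighbours `N` will merge. At most one neighbour
-- in each keeps the board a forest.
record Block {r} (B : Board r) (N X : List ℕ) : Set where
  field
    clo      : Closed B X
    N⊆X      : All (_∈ X) N
    separate : ∀ {a b} → a ∈ N → b ∈ N → Connected B a b → a ≡ b

block-++ : ∀ {r} {B : Board r} {N X M Y} → Disjoint X Y → Block B N X → Block B M Y → Block B (N ++ M) (X ++ Y)
block-++ {B = B} {N} {X} {M} {Y} disj b₁ b₂ = record
  { clo      = closed-++ B₁.clo B₂.clo
  ; N⊆X      = all-++ (All.map ∈-++⁺ˡ B₁.N⊆X) (All.map (∈-++⁺ʳ X) B₂.N⊆X)
  ; separate = λ a∈ b∈ c → sep (∈-++⁻ N a∈) (∈-++⁻ N b∈) c
  }
  where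
  module B₁ = Block b₁
  module B₂ = Block b₂
  sep : ∀ {a b} → a ∈ N ⊎ a ∈ M → b ∈ N ⊎ b ∈ M → Connected B a b → a ≡ b
  sep (inj₁ a∈) (inj₁ b∈) c = B₁.separate a∈ b∈ c
  sep (inj₂ a∈) (inj₂ b∈) c = B₂.separate a∈ b∈ c
  sep (inj₁ a∈) (inj₂ b∈) c = contradiction (Closed.absorb-conn B₁.clo (All.lookup B₁.N⊆X a∈) c , All.lookup B₂.N⊆X b∈) disj
  sep (inj₂ a∈) (inj₁ b∈) c = contradiction (All.lookup B₁.N⊆X b∈ , Closed.absorb-conn B₂.clo (All.lookup B₂.N⊆X a∈) c) disj

module Attach {r} (B : Board r) {N X : List ℕ} (block : Block B N X) where
  open Block block
  open Closed clo

  N< : All (_< length B) N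
  N< = All.map (All.lookup inside) N⊆X

  open Extend B N N< public

  module _ {c : Fin r} where

    closed-new : Closed (_▷_ c) (new ∷ X)
    closed-new = closed (new-< ∷ All.map <-old inside) absorb′
      where
      absorb′ : ∀ {x y} → x ∈ new ∷ X → Adj (_▷_ c) x y → y ∈ new ∷ X
      absorb′ (here refl) e = there (All.lookup N⊆X (adj-new-inv {c} e))
      absorb′ {y = y} (there x∈) e with y ≟ new
      ... | yes refl = here refl
      ... | no y≢    = there (absorb x∈ (adj-inv {c} (All.lookup inside x∈) (<-inv {c} (adj-<ʳ (_▷_ c) e) y≢) e))

    closed-old : ∀ {Y} → Disjoint N Y → Closed B Y → Closed (_▷_ c) Y
    closed-old {Y} disj (closed Y< Y-abs) = closed (All.map <-old Y<) absorb′
      where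
      absorb′ : ∀ {x y} → x ∈ Y → Adj (_▷_ c) x y → y ∈ Y
      absorb′ {y = y} x∈ e with y ≟ new
      ... | yes refl = contradiction (adj-new-inv {c} (adj-sym (_▷_ c) e) , x∈) disj
      ... | no y≢    = Y-abs x∈ (adj-inv {c} (All.lookup Y< x∈) (<-inv {c} (adj-<ʳ (_▷_ c) e) y≢) e)

    conn-outside : ∀ {x y} → x ∉ new ∷ X → Connected (_▷_ c) x y → Connected B x y
    conn-outside x∉ (here x<)    = here (<-inv {c} x< (x∉ ∘ here))
    conn-outside x∉ (there {w = w} e d) =
      there (adj-inv {c} (<-inv {c} (adj-<ˡ (_▷_ c) e) (x∉ ∘ here)) (<-inv {c} (adj-<ʳ (_▷_ c) e) (w∉ ∘ here)) e) (conn-outside w∉ d)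
      where
      w∉ : w ∉ new ∷ X
      w∉ w∈ = x∉ (Closed.absorb closed-new w∈ (adj-sym (_▷_ c) e))

    components : ∀ {k} → ComponentsAtMost k B → suc (length X) ≤ k → ComponentsAtMost k (_▷_ c)
    components small X≤ v vs uq conn with v ∈? (new ∷ X)
    ... | yes v∈ = ≤-trans (unique-⊆-length uq λ x∈ → Closed.absorb-conn closed-new v∈ (All.lookup conn x∈)) X≤
    ... | no v∉  = small v vs uq (All.map (conn-outside v∉) conn)

    -- `b` is the vertex from which the walk enters `new`. The last alternative lets `no-loop` see
    -- that a cycle leaves and enters `new` by two different neighbours, which `separate` forbids.
    return : ∀ {a} xs → Walk (_▷_ c) (a ∷ xs ++ [ new ]) → new ∉ a ∷ xs →
             ∃ λ b → b ∈ N × Connected B a b × b ∈ a ∷ xs × (xs ≡ [] ⊎ b ∈ xs)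
    return {a} [] (step e _) n∉ =
      a , adj-new-inv {c} (adj-sym (_▷_ c) e) , here (<-inv {c} (adj-<ˡ (_▷_ c) e) (n∉ ∘ here ∘ sym)) , here refl , inj₁ refl
    return {a} (x ∷ xs) (step e w) n∉ with return xs w (n∉ ∘ there)
    ... | b , b∈N , conn , b∈ , _ = b , b∈N , there a~x conn , there b∈ , inj₂ b∈
      where
      a~x : Adj B a x
      a~x = adj-inv {c} (<-inv {c} (adj-<ˡ (_▷_ c) e) (n∉ ∘ here ∘ sym)) (<-inv {c} (adj-<ʳ (_▷_ c) e) (λ { refl → n∉ (there (here refl)) })) e

    no-loop : ∀ ws → 2 ≤ length ws → Unique (new ∷ ws) → ¬ Walk (_▷_ c) (new ∷ ws ++ [ new ])
    no-loop (_ ∷ []) (s≤s ())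
    no-loop (a ∷ x ∷ ws) _ u@(_ ∷ ua) (step e w) with return (x ∷ ws) w (unique-∉ u)
    ... | b , b∈N , conn , _ , inj₂ b∈ws with separate (adj-new-inv {c} e) b∈N conn
    ...   | refl = unique-∉ ua b∈ws

    forest : IsForest B → IsForest (_▷_ c)
    forest acyclic (v , ws , long , uq , w) with new ∈? (v ∷ ws)
    ... | no n∉ = acyclic (v , ws , long , uq , walk-inv w n∉′)
      where
      n∉′ : new ∉ v ∷ ws ++ [ v ]
      n∉′ n∈ with ∈-++⁻ (v ∷ ws) n∈
      ... | inj₁ n∈ws       = n∉ n∈ws
      ... | inj₂ (here refl) = n∉ (here refl)
    ... | yes (here refl) = no-loop ws long uq w
    ... | yes (there n∈) with ∈-∃++ n∈
    -- The cycle is rotated so that it starts at `new`.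
    ...   | as , bs , refl = no-loop (bs ++ v ∷ as) long′ (unique-swap (v ∷ as) uq)
                             (subst (λ vs → Walk (_▷_ c) (new ∷ vs)) (sym (++-assoc bs (v ∷ as) [ new ]))
                               (walk-++ (new ∷ bs) (walk-suffix (v ∷ as) w′) (walk-prefix (v ∷ as) w′)))
      where
      w′ : Walk (_▷_ c) ((v ∷ as) ++ new ∷ (bs ++ [ v ]))
      w′ = subst (Walk (_▷_ c)) (++-assoc (v ∷ as) (new ∷ bs) [ v ]) w
      long′ : 2 ≤ length (bs ++ v ∷ as)
      long′ = ≤-trans long (≤-reflexive (trans (length-++ as) (trans (+-suc _ _) (trans (cong suc (+-comm (length as) _))
                (trans (sym (+-suc _ _)) (sym (length-++ bs)))))))

-- `Walk` excludes the empty list, but table entries at 0 need a path on no vertices.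
data Path {r} (B : Board r) : List ℕ → Set where
  none : Path B []
  some : ∀ {v vs} → Walk B (v ∷ vs) → Path B (v ∷ vs)

-- `fp` is the footprint: whole components around the path, whose total size is bounded by the price
-- `z`.
record Piece (B : Board 2) (s : Fin 2) (m z : ℕ) (C : List ℕ) : Set where
  field
    {vs fp} : List ℕ
    len     : length vs ≡ m
    path    : Path B vs
    uq      : Unique vs
    mono    : Mono B s vs
    vs⊆fp   : All (_∈ fp) vs
    clo     : Closed B fp
    fp⊆C    : All (_∈ C) fp
    size    : length fp ≤ z

  ends : List ℕ
  ends = take 1 vs

  block : Block B ends fp
  block = record { clo = clo ; N⊆X = all-take 1 vs⊆fp ; separate = sep vs }
    where
    sep : ∀ vs {a b} → a ∈ take 1 vs → b ∈ take 1 vs → Connected B a b → a ≡ b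
    sep (_ ∷ _) (here refl) (here refl) _ = refl

Wild : Board 2 → ℕ → Table → List ℕ → Set
Wild B k t C = ∀ s m → t s m ≤ k → Piece B s m (t s m) C

empty-piece : ∀ {B s C} → Piece B s 0 0 C
empty-piece = record { vs = [] ; fp = [] ; len = refl ; path = none ; uq = [] ; mono = [] ; vs⊆fp = []
                     ; clo = closed [] λ () ; fp⊆C = [] ; size = z≤n }

piece-⊆ : ∀ {B s m z C D} → (∀ {x} → x ∈ C → x ∈ D) → Piece B s m z C → Piece B s m z D
piece-⊆ sub π = record { Piece π hiding (fp⊆C; ends; block) ; fp⊆C = All.map sub (Piece.fp⊆C π) }

update : Table → Fin 2 → ℕ → ℕ → Table
update t s₀ m₀ S s m with s ≟F s₀ | m ≟ m₀
... | yes _ | yes _ = S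
... | _     | _     = t s m

update-same : ∀ t s m S → update t s m S s m ≡ S
update-same t s m S with s ≟F s | m ≟ m
... | yes _ | yes _ = refl
... | yes _ | no m≢m = contradiction refl m≢m
... | no s≢s | _     = contradiction refl s≢s

update-other : ∀ t s₀ m₀ S s m → s ≢ s₀ ⊎ m ≢ m₀ → update t s₀ m₀ S s m ≡ t s m
update-other t s₀ m₀ S s m diff with s ≟F s₀ | m ≟ m₀
... | no _     | _        = refl
... | yes _    | no _     = refl
... | yes refl | yes refl = [ contradiction refl , contradiction refl ]′ diff

wild-update : ∀ {B k t C s₀ m₀ S} → Wild B k t C → Piece B s₀ m₀ S C → Wild B k (update t s₀ m₀ S) C
wild-update {s₀ = s₀} {m₀} w π s m h with s ≟F s₀ | m ≟ m₀
... | yes refl | yes refl = π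
... | yes _    | no _     = w s m h
... | no _     | yes _    = w s m h
... | no _     | no _     = w s m h

module _ (B : Board 2) {N X : List ℕ} (bl : Block B N X) where
  open Attach B bl
  open Block bl

  piece-lift : ∀ {c s m z C} → Disjoint N C → Piece B s m z C → Piece (_▷_ c) s m z C
  piece-lift {c} {s} disj π = record
    { len = Π.len ; path = lift-path Π.path ; uq = Π.uq ; mono = mono-old (All.map (All.lookup (Closed.inside Π.clo)) Π.vs⊆fp) Π.mono
    ; vs⊆fp = Π.vs⊆fp ; clo = closed-old (λ { (x∈ , x∈′) → disj (x∈ , All.lookup Π.fp⊆C x∈′) }) Π.clo ; fp⊆C = Π.fp⊆C ; size = Π.size }
    where
    module Π = Piece π
    lift-path : ∀ {vs} → Path B vs → Path (_▷_ c) vs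
    lift-path none     = none
    lift-path (some w) = some (walk-old w)

  -- The footprint is all of `new ∷ X`, including the trees of the other colour, which now belong to
  -- the same component.
  piece-join : ∀ {c m n z z′ S C C′ D} (π : Piece B c m z C) (ρ : Piece B c n z′ C′) →
               All (_∈ N) (Piece.ends π) → All (_∈ N) (Piece.ends ρ) → Disjoint C C′ →
               (∀ {x} → x ∈ Piece.fp π → x ∈ X) → (∀ {x} → x ∈ Piece.fp ρ → x ∈ X) →
               (∀ {x} → x ∈ X → x ∈ D) → new ∈ D →
               suc (length X) ≤ S → Piece (_▷_ c) c (suc (m + n)) S D
  piece-join {c} {m} {n} π ρ π∈ ρ∈ disj π⊆ ρ⊆ X⊆D new∈D size = record
    { vs    = Left.vs ʳ++ (new ∷ Right.vs)
    ; fp    = new ∷ X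
    ; len   = trans (length-ʳ++ Left.vs) (trans (+-suc _ _) (cong suc (cong₂ _+_ Left.len Right.len)))
    ; path  = to-path (walk-join Left.vs (from-new Left.path π∈) (from-new Right.path ρ∈))
    ; uq    = unique-join Left.vs Left.uq (unique-cons (new∉ Right.vs⊆fp Right.clo) Right.uq)
                λ { (n∈ , here refl) → new∉ Left.vs⊆fp Left.clo n∈
                  ; (x∈ , there x∈′) → disj (All.lookup Left.fp⊆C (All.lookup Left.vs⊆fp x∈) , All.lookup Right.fp⊆C (All.lookup Right.vs⊆fp x∈′)) }
    ; mono  = all-join Left.vs (mono-old (inside Left.vs⊆fp Left.clo) Left.mono) (color-new ∷ mono-old (inside Right.vs⊆fp Right.clo) Right.mono)
    ; vs⊆fp = all-join Left.vs (All.map (there ∘ π⊆) Left.vs⊆fp) (here refl ∷ All.map (there ∘ ρ⊆) Right.vs⊆fp)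
    ; clo   = closed-new
    ; fp⊆C  = new∈D ∷ All.tabulate X⊆D
    ; size  = size
    }
    where
    module Left = Piece π
    module Right = Piece ρ
    inside : ∀ {vs fp} → All (_∈ fp) vs → Closed B fp → All (_< new) vs
    inside sub clo = All.map (All.lookup (Closed.inside clo)) sub
    new∉ : ∀ {vs fp} → All (_∈ fp) vs → Closed B fp → new ∉ vs
    new∉ sub clo n∈ = n≮n _ (All.lookup (inside sub clo) n∈)
    from-new : ∀ {vs} → Path B vs → All (_∈ N) (take 1 vs) → Walk (_▷_ c) (new ∷ vs)
    from-new none     _        = single new-<
    from-new (some w) (v∈ ∷ _) = step (adj-new {c} v∈) (walk-old w)
    to-path : ∀ {vs} → Walk (_▷_ c) vs → Path (_▷_ c) vs
    to-path w@(single _) = some w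
    to-path w@(step _ _) = some w

allPairs-insert : ∀ {a r} {A : Set a} {R : A → A → Set r} → (∀ {x y} → R x y → R y x) → ∀ xs {ys c} →
                  AllPairs R (xs ++ ys) → All (R c) (xs ++ ys) → AllPairs R (xs ++ c ∷ ys)
allPairs-insert R-sym []       ap        rc        = rc ∷ ap
allPairs-insert R-sym (x ∷ xs) (rx ∷ ap) (rcx ∷ rc) with all-split xs rx
... | rx₁ , rx₂ = all-++ rx₁ (R-sym rcx ∷ rx₂) ∷ allPairs-insert R-sym xs ap rc

disjoint-++ : ∀ {a} {A : Set a} (xs : List A) {ys zs} → Disjoint xs zs → Disjoint ys zs → Disjoint (xs ++ ys) zs
disjoint-++ xs dx dy (v∈ , v∈zs) = [ (λ v∈xs → dx (v∈xs , v∈zs)) , (λ v∈ys → dy (v∈ys , v∈zs)) ]′ (∈-++⁻ xs v∈)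

all-disjoint-++ : ∀ {a} {A : Set a} (xs : List A) {ys zss} → All (Disjoint xs) zss → All (Disjoint ys) zss → All (Disjoint (xs ++ ys)) zss
all-disjoint-++ xs []       []       = []
all-disjoint-++ xs (d ∷ ds) (e ∷ es) = disjoint-++ xs d e ∷ all-disjoint-++ xs ds es

disjoint-sym : ∀ {a} {A : Set a} {xs ys : List A} → Disjoint xs ys → Disjoint ys xs
disjoint-sym d (y∈ , x∈) = d (x∈ , y∈)

-- Builder's game on tables

module Builder (ℓ k : ℕ) where

  Resource : Board 2 → Table → List ℕ → Set
  Resource B t C = All (_< length B) C × Wild B k t C

  -- Every region offers all entries of t, but at most one of its pieces is ever
  -- used, so the pieces inside one region may overlap.
  Wins : Table → Set
  Wins t = ∃ λ n → ∀ B Cs → Legal k B → n ≤ length Cs → AllPairs Disjoint Cs → All (Resource B t) Cs → BuilderWinsFrom ℓ k B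

  module Play (t : Table) (p q i j : ℕ) where
    S : ℕ
    S = t zero p + t zero q + (t (suc zero) i + t (suc zero) j) + 1

    red blue : Table
    red  = update t zero (suc (p + q)) S
    blue = update t (suc zero) (suc (i + j)) S

    answer : Fin 2 → Table
    answer zero       = red
    answer (suc zero) = blue

    module Move (S≤k : S ≤ k) (B : Board 2) (legal : Legal k B) {C₁ C₂ C₃ C₄ C₅ : List ℕ} {Cs : List (List ℕ)}
                (disj : AllPairs Disjoint (C₁ ∷ C₂ ∷ C₃ ∷ C₄ ∷ C₅ ∷ Cs))
                (r₁ : Resource B t C₁) (r₂ : Resource B t C₂) (r₃ : Resource B t C₃) (r₄ : Resource B t C₄) (r₅ : Resource B t C₅)
                (Cs< : All (All (_< length B)) Cs) where

      summands : t zero p ≤ k × t zero q ≤ k × t (suc zero) i ≤ k × t (suc zero) j ≤ k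
      summands = ≤-trans (m≤m+n a b) ab , ≤-trans (m≤n+m b a) ab , ≤-trans (m≤m+n c d) cd , ≤-trans (m≤n+m d c) cd
        where
        a = t zero p
        b = t zero q
        c = t (suc zero) i
        d = t (suc zero) j
        ab : a + b ≤ k
        ab = ≤-trans (m≤m+n (a + b) (c + d)) (≤-trans (m≤m+n _ 1) S≤k)
        cd : c + d ≤ k
        cd = ≤-trans (m≤n+m (c + d) (a + b)) (≤-trans (m≤m+n _ 1) S≤k)

      π₁ : Piece B zero p (t zero p) C₁
      π₁ = proj₂ r₁ zero p (proj₁ summands)
      π₂ : Piece B zero q (t zero q) C₂
      π₂ = proj₂ r₂ zero q (proj₁ (proj₂ summands))
      π₃ : Piece B (suc zero) i (t (suc zero) i) C₃
      π₃ = proj₂ r₃ (suc zero) i (proj₁ (proj₂ (proj₂ summands)))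
      π₄ : Piece B (suc zero) j (t (suc zero) j) C₄
      π₄ = proj₂ r₄ (suc zero) j (proj₂ (proj₂ (proj₂ summands)))

      module Π₁ = Piece π₁
      module Π₂ = Piece π₂
      module Π₃ = Piece π₃
      module Π₄ = Piece π₄

      N X W : List ℕ
      N = (Π₁.ends ++ Π₂.ends) ++ (Π₃.ends ++ Π₄.ends)
      X = (Π₁.fp ++ Π₂.fp) ++ (Π₃.fp ++ Π₄.fp)
      W = (C₁ ++ C₂) ++ (C₃ ++ C₄)

      pair-⊆ : ∀ {a} {A : Set a} {xs ys zs ws : List A} → All (_∈ zs) xs → All (_∈ ws) ys → All (_∈ (zs ++ ws)) (xs ++ ys)
      pair-⊆ {zs = zs} a b = all-++ (All.map ∈-++⁺ˡ a) (All.map (∈-++⁺ʳ zs) b)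

      disjoint-⊆ : ∀ {xs ys zs ws : List ℕ} → All (_∈ zs) xs → All (_∈ ws) ys → Disjoint zs ws → Disjoint xs ys
      disjoint-⊆ a b d (x∈ , y∈) = d (All.lookup a x∈ , All.lookup b y∈)

      X⊆W : All (_∈ W) X
      X⊆W = pair-⊆ (pair-⊆ Π₁.fp⊆C Π₂.fp⊆C) (pair-⊆ Π₃.fp⊆C Π₄.fp⊆C)

      apart : Disjoint C₁ C₂ × Disjoint C₃ C₄ × Disjoint (C₁ ++ C₂) (C₃ ++ C₄) × Disjoint W C₅ × All (Disjoint (W ++ C₅)) Cs
      apart = go disj
       where
       go : AllPairs Disjoint (C₁ ∷ C₂ ∷ C₃ ∷ C₄ ∷ C₅ ∷ Cs) →
            Disjoint C₁ C₂ × Disjoint C₃ C₄ × Disjoint (C₁ ++ C₂) (C₃ ++ C₄) × Disjoint W C₅ × All (Disjoint (W ++ C₅)) Cs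
       go ((d₁₂ ∷ d₁₃ ∷ d₁₄ ∷ d₁₅ ∷ d₁) ∷ (d₂₃ ∷ d₂₄ ∷ d₂₅ ∷ d₂) ∷ (d₃₄ ∷ d₃₅ ∷ d₃) ∷ (d₄₅ ∷ d₄) ∷ d₅ ∷ _) =
        d₁₂ , d₃₄ , disjoint-sym (disjoint-++ C₃ (disjoint-sym (disjoint-++ C₁ d₁₃ d₂₃)) (disjoint-sym (disjoint-++ C₁ d₁₄ d₂₄))) ,
        disjoint-++ (C₁ ++ C₂) (disjoint-++ C₁ d₁₅ d₂₅) (disjoint-++ C₃ d₃₅ d₄₅) ,
        all-disjoint-++ W (all-disjoint-++ (C₁ ++ C₂) (all-disjoint-++ C₁ d₁ d₂) (all-disjoint-++ C₃ d₃ d₄)) d₅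

      bl : Block B N X
      bl = block-++ (disjoint-⊆ (pair-⊆ Π₁.fp⊆C Π₂.fp⊆C) (pair-⊆ Π₃.fp⊆C Π₄.fp⊆C) (proj₁ (proj₂ (proj₂ apart))))
             (block-++ (disjoint-⊆ Π₁.fp⊆C Π₂.fp⊆C (proj₁ apart)) Π₁.block Π₂.block)
             (block-++ (disjoint-⊆ Π₃.fp⊆C Π₄.fp⊆C (proj₁ (proj₂ apart))) Π₃.block Π₄.block)

      open Attach B bl

      size : suc (length X) ≤ S
      size = ≤-trans (≤-reflexive (+-comm 1 (length X))) (+-monoˡ-≤ 1 (≤-trans (≤-reflexive
               (trans (length-++ (Π₁.fp ++ Π₂.fp)) (cong₂ _+_ (length-++ Π₁.fp) (length-++ Π₃.fp))))
               (+-mono-≤ (+-mono-≤ Π₁.size Π₂.size) (+-mono-≤ Π₃.size Π₄.size))))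

      legal-▷ : ∀ c → Legal k (_▷_ c)
      legal-▷ c = forest (proj₁ legal) , components (proj₂ legal) (≤-trans size S≤k)

      -- The move uses up `C₁` to `C₄`; the untouched `C₅` still offers every old entry, and the new
      -- path is added to it.
      C′ : List ℕ
      C′ = new ∷ (W ++ C₅)

      N⊆W : All (_∈ W) N
      N⊆W = All.map (All.lookup X⊆W) (Block.N⊆X bl)

      survivor : ∀ {c u D} → Disjoint W D → Resource B u D → Resource (_▷_ c) u D
      survivor d (D< , w) = All.map <-old D< , λ s m h → piece-lift B bl (λ { (n∈ , x∈) → d (All.lookup N⊆W n∈ , x∈) }) (w s m h)

      fresh : All (Disjoint C′) Cs
      fresh = go (proj₂ (proj₂ (proj₂ (proj₂ apart)))) Cs<
        where
        go : ∀ {Ds} → All (Disjoint (W ++ C₅)) Ds → All (All (_< new)) Ds → All (Disjoint C′) Ds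
        go []       []         = []
        go (d ∷ ds) (D< ∷ Ds<) = (λ { (here refl , x∈) → n≮n _ (All.lookup D< x∈) ; (there x∈ , x∈′) → d (x∈ , x∈′) }) ∷ go ds Ds<

      others : ∀ {D} → D ∈ Cs → Disjoint W D
      others D∈ (x∈ , x∈′) = All.lookup (proj₂ (proj₂ (proj₂ (proj₂ apart)))) D∈ (∈-++⁺ˡ x∈ , x∈′)

      X⊆C′ : ∀ {x} → x ∈ X → x ∈ C′
      X⊆C′ x∈ = there (∈-++⁺ˡ (All.lookup X⊆W x∈))

      C′< : ∀ {c} → All (_< length (_▷_ c)) C′
      C′< = new-< ∷ All.map <-old (all-++ (all-++ (all-++ (proj₁ r₁) (proj₁ r₂)) (all-++ (proj₁ r₃) (proj₁ r₄))) (proj₁ r₅))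

      wild-C′ : ∀ {c} → Wild (_▷_ c) k t C′
      wild-C′ {c} s m h = piece-⊆ (λ x∈ → there (∈-++⁺ʳ W x∈)) (proj₂ (survivor {c} (proj₁ (proj₂ (proj₂ (proj₂ apart)))) r₅) s m h)

      upgraded : ∀ c → Resource (_▷_ c) (answer c) C′
      upgraded zero       = C′< , wild-update wild-C′
        (piece-join B bl π₁ π₂ (All.tabulate λ x∈ → ∈-++⁺ˡ (∈-++⁺ˡ x∈)) (All.tabulate λ x∈ → ∈-++⁺ˡ (∈-++⁺ʳ Π₁.ends x∈)) (proj₁ apart)
          (λ x∈ → ∈-++⁺ˡ (∈-++⁺ˡ x∈)) (λ x∈ → ∈-++⁺ˡ (∈-++⁺ʳ Π₁.fp x∈)) X⊆C′ (here refl) size)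
      upgraded (suc zero) = C′< , wild-update wild-C′
        (piece-join B bl π₃ π₄ (All.tabulate λ x∈ → ∈-++⁺ʳ (Π₁.ends ++ Π₂.ends) (∈-++⁺ˡ x∈)) (All.tabulate λ x∈ → ∈-++⁺ʳ (Π₁.ends ++ Π₂.ends) (∈-++⁺ʳ Π₃.ends x∈)) (proj₁ (proj₂ apart))
          (λ x∈ → ∈-++⁺ʳ (Π₁.fp ++ Π₂.fp) (∈-++⁺ˡ x∈)) (λ x∈ → ∈-++⁺ʳ (Π₁.fp ++ Π₂.fp) (∈-++⁺ʳ Π₃.fp x∈)) X⊆C′ (here refl) size)

    module _ (S≤k : S ≤ k) (n₀ n₁ : ℕ)
             (win₀ : ∀ B Cs → Legal k B → n₀ ≤ length Cs → AllPairs Disjoint Cs → All (Resource B red) Cs → BuilderWinsFrom ℓ k B)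
             (win₁ : ∀ B Cs → Legal k B → n₁ ≤ length Cs → AllPairs Disjoint Cs → All (Resource B blue) Cs → BuilderWinsFrom ℓ k B)
             where

      -- The same move is repeated on fresh regions, five per round, and the results are sorted by
      -- answer. After `n₀ + n₁` rounds there are `n₀` regions for the red table or `n₁` for the
      -- blue one.
      collect : ∀ x B Ts As Bs → Legal k B → 5 * x ≤ length Ts → n₀ + n₁ ≤ x + (length As + length Bs) →
                AllPairs Disjoint (Ts ++ As ++ Bs) → All (Resource B t) Ts → All (Resource B red) As → All (Resource B blue) Bs →
                BuilderWinsFrom ℓ k B
      collect zero B Ts As Bs legal _ enough disj ts as bs with allPairs-++⁻ Ts disj
      ... | _ , disj′ , _ with allPairs-++⁻ As disj′ | ≤-total n₀ (length As)
      ...   | dA , _ , _  | inj₁ n₀≤ = win₀ B As legal n₀≤ dA as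
      ...   | _ , dB , _  | inj₂ n₀≥ = win₁ B Bs legal
                (+-cancelˡ-≤ n₀ n₁ (length Bs) (≤-trans enough (+-monoˡ-≤ (length Bs) n₀≥))) dB bs
      collect (suc x) B Ts As Bs legal len enough disj ts as bs =
        go Ts (≤-trans (≤-reflexive (sym (*-suc 5 x))) len) disj ts
        where
        go : ∀ Ts → 5 + 5 * x ≤ length Ts → AllPairs Disjoint (Ts ++ As ++ Bs) → All (Resource B t) Ts → BuilderWinsFrom ℓ k B
        go []                  ()
        go (_ ∷ [])            (s≤s ())
        go (_ ∷ _ ∷ [])        (s≤s (s≤s ()))
        go (_ ∷ _ ∷ _ ∷ [])    (s≤s (s≤s (s≤s ())))
        go (_ ∷ _ ∷ _ ∷ _ ∷ []) (s≤s (s≤s (s≤s (s≤s ()))))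
        go (C₁ ∷ C₂ ∷ C₃ ∷ C₄ ∷ C₅ ∷ Ts) (s≤s (s≤s (s≤s (s≤s (s≤s len))))) disj@(_ ∷ _ ∷ _ ∷ _ ∷ _ ∷ rest) (r₁ ∷ r₂ ∷ r₃ ∷ r₄ ∷ r₅ ∷ ts) =
          move M.N (Attach.N< B M.bl) M.legal-▷ continue
          where
          module M = Move S≤k B legal disj r₁ r₂ r₃ r₄ r₅ (all-++ (All.map proj₁ ts) (all-++ (All.map proj₁ as) (All.map proj₁ bs)))
          lift : ∀ {c u Ds} → (∀ {D} → D ∈ Ds → D ∈ Ts ++ As ++ Bs) → All (Resource B u) Ds → All (Resource (B ++ [ (M.N , c) ]) u) Ds
          lift sub rs = All.tabulate λ D∈ → M.survivor (M.others (sub D∈)) (All.lookup rs D∈)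
          continue : ∀ c → BuilderWinsFrom ℓ k (B ++ [ (M.N , c) ])
          continue zero = collect x _ Ts (M.C′ ∷ As) Bs (M.legal-▷ zero) len (≤-trans enough (≤-reflexive (sym (+-suc x _))))
            (allPairs-insert disjoint-sym Ts rest M.fresh)
            (lift ∈-++⁺ˡ ts) (M.upgraded zero ∷ lift (λ D∈ → ∈-++⁺ʳ Ts (∈-++⁺ˡ D∈)) as) (lift (λ D∈ → ∈-++⁺ʳ Ts (∈-++⁺ʳ As D∈)) bs)
          continue (suc zero) = collect x _ Ts As (M.C′ ∷ Bs) (M.legal-▷ (suc zero)) len
            (≤-trans enough (≤-reflexive (trans (sym (+-suc x _)) (cong (x +_) (sym (+-suc (length As) (length Bs)))))))
            (subst (AllPairs Disjoint) (++-assoc Ts As (M.C′ ∷ Bs))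
              (allPairs-insert disjoint-sym (Ts ++ As) (subst (AllPairs Disjoint) (sym (++-assoc Ts As Bs)) rest)
                                                       (subst (All (Disjoint M.C′)) (sym (++-assoc Ts As Bs)) M.fresh)))
            (lift ∈-++⁺ˡ ts) (lift (λ D∈ → ∈-++⁺ʳ Ts (∈-++⁺ˡ D∈)) as) (M.upgraded (suc zero) ∷ lift (λ D∈ → ∈-++⁺ʳ Ts (∈-++⁺ʳ As D∈)) bs)

    wins-move : S ≤ k → Wins red → Wins blue → Wins t
    wins-move S≤k (n₀ , win₀) (n₁ , win₁) = 5 * (n₀ + n₁) , λ B Cs legal len disj rs →
      collect S≤k n₀ n₁ win₀ win₁ (n₀ + n₁) B Cs [] [] legal len (m≤m+n _ _)
        (subst (AllPairs Disjoint) (sym (++-identityʳ Cs)) disj) rs [] []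

  module _ (ℓ≥1 : 1 ≤ ℓ) where

    wins-long : ∀ t s m → ℓ ≤ m → t s m ≤ k → Wins t
    wins-long t s m ℓ≤m t≤k = 1 , win
      where
      win : ∀ B Cs → Legal k B → 1 ≤ length Cs → AllPairs Disjoint Cs → All (Resource B t) Cs → BuilderWinsFrom ℓ k B
      win B [] _ () _ _
      win B (C ∷ _) _ _ _ ((_ , wild) ∷ _) = lost (s , take ℓ Π.vs , trans (length-take ℓ Π.vs) (m≤n⇒m⊓n≡m (≤-trans ℓ≤m (≤-reflexive (sym Π.len)))) ,
                                                unique-take ℓ Π.uq , walk ℓ≥1 (≤-trans ℓ≥1 (≤-trans ℓ≤m (≤-reflexive (sym Π.len)))) Π.path , all-take ℓ Π.mono)
        where
        module Π = Piece (wild s m t≤k)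
        walk : ∀ {ℓ vs} → 1 ≤ ℓ → 1 ≤ length vs → Path B vs → Walk B (take ℓ vs)
        walk {suc ℓ} _ _  (some w) = walk-take ℓ w
        walk {suc ℓ} _ () none

    sum : ℕ → (ℕ → ℕ) → ℕ
    sum zero    f = 0
    sum (suc n) f = sum n f + f n

    sum-mono : ∀ n {f g} → (∀ m → f m ≤ g m) → sum n f ≤ sum n g
    sum-mono zero    h = z≤n
    sum-mono (suc n) h = +-mono-≤ (sum-mono n h) (h n)

    sum-strict : ∀ n {f g m} → m < n → f m < g m → (∀ m → f m ≤ g m) → sum n f < sum n g
    sum-strict (suc n) {m = m} (s≤s m≤n) lt h with m ≟ n
    ... | yes refl = +-mono-≤-< (sum-mono n h) lt
    ... | no m≢n   = +-mono-<-≤ (sum-strict n (≤∧≢⇒< m≤n m≢n) lt h) (h n)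

    -- Termination measure; an improvement at an index from `ℓ` on ends the game instead.
    weight : Table → ℕ
    weight t = sum ℓ (t zero) + sum ℓ (t (suc zero))

    update-≤ : ∀ t s₀ m₀ S → S < t s₀ m₀ → ∀ s m → update t s₀ m₀ S s m ≤ t s m
    update-≤ t s₀ m₀ S S< s m with s ≟F s₀ | m ≟ m₀
    ... | yes refl | yes refl = <⇒≤ S<
    ... | yes _    | no _     = ≤-refl
    ... | no _     | yes _    = ≤-refl
    ... | no _     | no _     = ≤-refl

    weight-update : ∀ t s m S → m < ℓ → S < t s m → weight (update t s m S) < weight t
    weight-update t zero       m S m< S< = +-mono-<-≤ (sum-strict ℓ m< (≤-trans (s≤s (≤-reflexive (update-same t zero m S))) S<) (update-≤ t zero m S S< zero))
                                             (sum-mono ℓ (update-≤ t zero m S S< (suc zero)))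
    weight-update t (suc zero) m S m< S< = +-mono-≤-< (sum-mono ℓ (update-≤ t (suc zero) m S S< zero))
                                             (sum-strict ℓ m< (≤-trans (s≤s (≤-reflexive (update-same t (suc zero) m S))) S<) (update-≤ t (suc zero) m S S< (suc zero)))

    record Proper (t : Table) : Set where
      field
        at-0 : ∀ s → t s 0 ≡ 0
        high : ∀ s m → ℓ ≤ m → k < t s m

    proper-update : ∀ {t} s m S → Proper t → suc m < ℓ → Proper (update t s (suc m) S)
    proper-update {t} s m S pr m< = record
      { at-0 = λ s′ → trans (update-other t s (suc m) S s′ 0 (inj₂ λ ())) (Proper.at-0 pr s′)
      ; high = λ s′ m′ ℓ≤ → subst (k <_) (sym (update-other t s (suc m) S s′ m′ (inj₂ λ { refl → <⇒≱ m< ℓ≤ }))) (Proper.high pr s′ m′ ℓ≤) }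

    StableProper : Table → Set
    StableProper t = Proper t × Stable 1 k (t zero) (t (suc zero))

    module _ (t : Table) where
      open Play t

      Improves : ℕ → ℕ → ℕ → ℕ → Set
      Improves p q i j = S p q i j ≤ k × S p q i j < t zero (suc (p + q)) × S p q i j < t (suc zero) (suc (i + j))

      improvement? : Dec (∃ λ p → p < ℓ × ∃ λ q → q < ℓ × ∃ λ i → i < ℓ × ∃ λ j → j < ℓ × Improves p q i j)
      improvement? = anyUpTo? (λ p → anyUpTo? (λ q → anyUpTo? (λ i → anyUpTo? (λ j →
        (S p q i j ≤? k) ×-dec ((S p q i j <? t zero (suc (p + q))) ×-dec (S p q i j <? t (suc zero) (suc (i + j))))) ℓ) ℓ) ℓ) ℓ

      -- The search over indices below `ℓ` is exhaustive because entries from `ℓ` on exceed `k` and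
      -- cannot occur in `S ≤ k`.
      no-improvement : Proper t → ¬ (∃ λ p → p < ℓ × ∃ λ q → q < ℓ × ∃ λ i → i < ℓ × ∃ λ j → j < ℓ × Improves p q i j) →
                       Stable 1 k (t zero) (t (suc zero))
      no-improvement pr stuck p q i j S≤1k with t zero (suc (p + q)) ≤? S p q i j | t (suc zero) (suc (i + j)) ≤? S p q i j
      ... | yes ≤S | _      = inj₁ ≤S
      ... | no _   | yes ≤S = inj₂ ≤S
      ... | no ≰S  | no ≰S′ = contradiction (p , below zero p (m≤m+n (t zero p) _ ∙ ab) , q , below zero q (m≤n+m (t zero q) (t zero p) ∙ ab) ,
                                i , below (suc zero) i (m≤m+n (t (suc zero) i) _ ∙ cd) , j , below (suc zero) j (m≤n+m (t (suc zero) j) (t (suc zero) i) ∙ cd) ,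
                                S≤k , ≰⇒> ≰S , ≰⇒> ≰S′) stuck
        where
        infixr 5 _∙_
        _∙_ : ∀ {a b c} → a ≤ b → b ≤ c → a ≤ c
        _∙_ = ≤-trans
        S≤k : S p q i j ≤ k
        S≤k = ≤-trans S≤1k (≤-reflexive (*-identityˡ k))
        ab : t zero p + t zero q ≤ k
        ab = m≤m+n _ (t (suc zero) i + t (suc zero) j) ∙ m≤m+n _ 1 ∙ S≤k
        cd : t (suc zero) i + t (suc zero) j ≤ k
        cd = m≤n+m _ (t zero p + t zero q) ∙ m≤m+n _ 1 ∙ S≤k
        below : ∀ s m → t s m ≤ k → m < ℓ
        below s m t≤ with <-≤-connex m ℓ
        ... | inj₁ m< = m<
        ... | inj₂ m≥ = contradiction t≤ (<⇒≱ (Proper.high pr s m m≥))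

    -- A violated quadruple is a move that lowers an entry under either answer. At an index from `ℓ`
    -- on this wins for Builder, otherwise the weight drops; without a violation the table is
    -- stable.
    wins-or-stable : ∀ w t → weight t < w → Proper t → Wins t ⊎ ∃ StableProper
    wins-or-stable (suc w) t t<w pr with improvement? t
    ... | no stuck = inj₂ (t , pr , no-improvement t pr stuck)
    ... | yes (p , _ , q , _ , i , _ , j , _ , S≤k , red< , blue<) with branch zero (p + q) red< | branch (suc zero) (i + j) blue<
      where
      open Play t p q i j using (S)
      branch : ∀ s m → S < t s (suc m) → Wins (update t s (suc m) S) ⊎ ∃ StableProper
      branch s m S< with <-≤-connex (suc m) ℓ
      ... | inj₁ m< = wins-or-stable w (update t s (suc m) S) (≤-trans (weight-update t s (suc m) S m< S<) (s≤s⁻¹ t<w)) (proper-update s m S pr m<)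
      ... | inj₂ m≥ = inj₁ (wins-long _ s (suc m) m≥ (≤-trans (≤-reflexive (update-same t s (suc m) S)) S≤k))
    ...   | inj₂ stable | _           = inj₂ stable
    ...   | _           | inj₂ stable = inj₂ stable
    ...   | inj₁ win₀   | inj₁ win₁   = inj₁ (Play.wins-move t p q i j S≤k win₀ win₁)

    initial : Table
    initial s zero    = 0
    initial s (suc m) = suc k

    proper-initial : Proper initial
    proper-initial = record { at-0 = λ _ → refl ; high = λ { s zero ℓ≤0 → contradiction (≤-trans ℓ≥1 ℓ≤0) λ () ; s (suc m) _ → ≤-refl } }

    -- The empty board offers any number of empty regions, which are pairwise disjoint and contain
    -- the paths on no vertices.
    initial-wins : Wins initial → BuilderWins ℓ k
    initial-wins (n , win) = win [] (replicate n []) legal (≤-reflexive (sym (length-replicate n))) (disjoint n) (resources n)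
      where
      legal : Legal k []
      legal = (λ { (_ , [] , () , _) ; (_ , _ ∷ _ , _ , _ , step (inj₁ (_ , () , _)) _) ; (_ , _ ∷ _ , _ , _ , step (inj₂ (_ , () , _)) _) }) ,
              λ { v [] _ _ → z≤n ; v (_ ∷ _) _ (here () ∷ _) ; v (_ ∷ _) _ (there (inj₁ (_ , () , _)) _ ∷ _) ; v (_ ∷ _) _ (there (inj₂ (_ , () , _)) _ ∷ _) }
      all-empty : ∀ n → All (Disjoint []) (replicate n [])
      all-empty zero    = []
      all-empty (suc n) = (λ { (() , _) }) ∷ all-empty n
      disjoint : ∀ n → AllPairs (Disjoint {A = ℕ}) (replicate n [])
      disjoint zero    = []
      disjoint (suc n) = all-empty n ∷ disjoint n
      wild : Wild [] k initial []
      wild s zero    _ = empty-piece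
      wild s (suc m) h = contradiction h (n≮n k)
      resources : ∀ n → All (Resource [] initial) (replicate n [])
      resources zero    = []
      resources (suc n) = ([] , wild) ∷ resources n

    builder-or-stable : BuilderWins ℓ k ⊎ ∃ StableProper
    builder-or-stable with wins-or-stable (suc (weight initial)) initial ≤-refl proper-initial
    ... | inj₁ wins   = inj₁ (initial-wins wins)
    ... | inj₂ stable = inj₂ stable

-- The value of k*

n<2^n : ∀ n → n < 2 ^ n
n<2^n zero    = s≤s z≤n
n<2^n (suc n) = ≤-trans (s≤s (n<2^n n)) (≤-trans (+-monoˡ-≤ (2 ^ n) (m^n>0 2 n)) (+-monoʳ-≤ (2 ^ n) (m≤m+n _ 0)))

least : ∀ {p} {P : ℕ → Set p} → (∀ n → Dec (P n)) → ∀ N → P N → ∃ λ n → n ≤ N × P n × (∀ m → m < n → ¬ P m)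
least {P = P} P? N PN = [ (λ { (n , n<1+N , found) → n , s≤s⁻¹ n<1+N , found }) , (λ fails → contradiction PN (fails N ≤-refl)) ]′ (search (suc N))
  where
  search : ∀ N → (∃ λ n → n < N × P n × (∀ m → m < n → ¬ P m)) ⊎ (∀ m → m < N → ¬ P m)
  search zero = inj₂ λ _ ()
  search (suc N) with search N | P? N
  ... | inj₁ (n , n<N , found) | _     = inj₁ (n , m≤n⇒m≤1+n n<N , found)
  ... | inj₂ fails              | yes h = inj₁ (N , ≤-refl , h , fails)
  ... | inj₂ fails              | no ¬h = inj₂ λ m m<1+N → [ fails m , (λ { refl → ¬h }) ]′ (m≤n⇒m<n∨m≡n (s≤s⁻¹ m<1+N))

painter-table : ∀ {D k ℓ} (t : Table) → (∀ s → t s 0 ≡ 0) → (∀ s → D * k < t s ℓ) → Stable D k (t zero) (t (suc zero)) → ¬ BuilderWins ℓ k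
painter-table {D} {k} t t-zero t> stable = Painter.painter-wins D k t t-zero stable t>

-- The table search decides the game: stable tables with `D = 1` are a strategy for Painter.
builder-wins? : ∀ {ℓ} → 1 ≤ ℓ → ∀ k → Dec (BuilderWins ℓ k)
builder-wins? {ℓ} ℓ≥1 k with Builder.builder-or-stable ℓ k ℓ≥1
... | inj₁ wins              = yes wins
... | inj₂ (t , pr , stable) = no (painter-table t (Builder.Proper.at-0 pr)
        (λ s → subst (_< t s ℓ) (sym (*-identityˡ k)) (Builder.Proper.high pr s ℓ ≤-refl)) stable)

builder-upper : ∀ {ℓ t} → 1 ≤ ℓ → ℓ < 2 ^ suc t → BuilderWins ℓ (3 ^ t * ℓ)
builder-upper {ℓ} {t} ℓ≥1 ℓ< with Builder.builder-or-stable ℓ (3 ^ t * ℓ) ℓ≥1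
... | inj₁ wins = wins
... | inj₂ (T , pr , stable) = contradiction stable (unstable {t = t} ℓ< (at-0 zero) (at-0 (suc zero)) (high zero) (high (suc zero)))
  where open Builder.Proper pr

pair : (f g : ℕ → ℕ) → Table
pair f g zero       = f
pair f g (suc zero) = g

builder-lower : ∀ {ℓ k} n → 8 * 2048 ^ n ≤ ℓ → BuilderWins ℓ k → 4 * (2048 ^ n * 56448 ^ n) ≤ 25 ^ n * k
builder-lower {ℓ} {k} n ≤ℓ wins = ≮⇒≥ λ small →
  let f , g , stable , f-zero , g-zero , f> , g> = stable-tables n k small in
  painter-table (pair f g) (λ { zero → f-zero ; (suc zero) → g-zero }) (λ { zero → f> ℓ ≤ℓ ; (suc zero) → g> ℓ ≤ℓ }) stable wins

k*-bounds : ∀ a → (∀ n ℓ k → ℓ < 8 * 2048 ^ suc n → 4 * (2048 ^ n * 56448 ^ n) ≤ 25 ^ n * k → ℓ ^ 201 ≤ (a * k) ^ 100) →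
            ∀ ℓ → 8 ≤ ℓ → Σ ℕ λ k → IsKStar ℓ k × ℓ ^ 201 ≤ (a * k) ^ 100 × k ^ 100 ≤ 1 ^ 100 * ℓ ^ 259
k*-bounds a lower ℓ 8≤ℓ =
  let ℓ≥1 = ≤-trans (decide-≤ 1 8) 8≤ℓ
      t , t≤ , <t = bracket (2 ^_) ℓ ℓ≥1 (n<2^n ℓ)
      -- The hypothesis `8 ≤ ℓ` makes the scale `n = 0` available.
      n , n≤ , <n = bracket (λ n → 8 * 2048 ^ n) ℓ 8≤ℓ
                      (≤-trans (n<2^n ℓ) (≤-trans (^-monoˡ-≤ ℓ (decide-≤ 2 2048)) (m≤m+n (2048 ^ ℓ) _)))
      k , k≤ , wins , minimal = least (builder-wins? ℓ≥1) (3 ^ t * ℓ) (builder-upper {t = t} ℓ≥1 <t)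
  in k , (wins , minimal) , lower n ℓ k <n (builder-lower n n≤ wins) , upper-bound t ℓ k t≤ k≤

theorem4 : Σ ℕ λ a → Σ ℕ λ b → Σ ℕ λ L → 1 ≤ a × 1 ≤ b ×
    (∀ ℓ → L ≤ ℓ → Σ ℕ λ k → IsKStar ℓ k ×
    ℓ ^ 201 ≤ (a * k) ^ 100 × k ^ 100 ≤ b ^ 100 * ℓ ^ 259)
theorem4 = 2 ^ 27 , 1 , 8 , m^n>0 2 27 , ≤-refl , k*-bounds (2 ^ 27) lower-bound
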